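{- Let $n_g$ be the number of numerical semigroups of genus $g$, and let $i_g$ be the number of numerical semigroups of genus $g$ that are in an infinite chain. For every integer $g\geq 5$, $$i_g\leq\frac{1}{2}n_g.$$
   Context: A numerical semigroup is a subset $\Lambda\subseteq\mathbb{N}_0=\{0,1,2,\dots\}$ containing $0$, closed under addition, with finite complement in $\mathbb{N}_0$. Its genus is the cardinality of the complement. Its conductor $c(\Lambda)$ is the smallest $c\in\mathbb{N}_0$ with $\{\ell\in\mathbb{N}_0:\ell\ge c\}\subseteq\Lambda$. The effective generators of $\Lambda$ are the minimal generators of $\Lambda$ that are at least $c(\Lambda)$. The children of $\Lambda$ are the numerical semigroups $\Lambda\setminus\{a\}$ with $a$ an effective generator of $\Lambda$; $\Lambda$ is then the parent of each of these. An infinite chain is an infinite sequence of numerical semigroups $\Lambda_0,\Lambda_1,\Lambda_2,\dots$ such that $\Lambda_0=\mathbb{N}_0$ and $\Lambda_i$ is the parent of $\Lambda_{i+1}$ for all $i\ge 0$; a numerical semigroup is in the chain if it is one of the $\Lambda_i$. -}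

module Defs where

open import Data.Fin using (Fin)
open import Data.Fin.Permutation using (↔⇒≡)
open import Data.Nat using (ℕ; suc; _+_; _≤_)
open import Data.Product using (Σ; ∃; _×_; proj₁)
open import Function.Bundles using (Inverse)
import Function.Construct.Composition as Composition
import Function.Construct.Symmetry as Symmetry
open import Level using (Level; 0ℓ)
open import Relation.Binary.Bundles using (Setoid)
import Relation.Binary.Construct.On as On
open import Relation.Binary.PropositionalEquality using (_≡_; setoid)
open import Relation.Unary using (Pred; Decidable; U; ∁; ｛_｝; _∈_; _⊆_; _≐_; _∖_)
open import Relation.Unary.Relation.Binary.Equality using (≐-setoid)

private variable
  a ℓ p : Level

-- Elements are compared through their first projection, so different proofs
-- of P x do not count as different elements.
Subsetoid : (S : Setoid a ℓ) → Pred (Setoid.Carrier S) p → Setoid _ _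
Subsetoid S P = On.setoid {B = Σ (Setoid.Carrier S) P} S proj₁

HasCardinality : Setoid a ℓ → ℕ → Set _
HasCardinality S n = Inverse (setoid (Fin n)) S

cardinality-unique : {S : Setoid a ℓ} {m n : ℕ} →
                     HasCardinality S m → HasCardinality S n → m ≡ n
cardinality-unique f g = ↔⇒≡ (Composition.inverse f (Symmetry.inverse g))

-- Membership is required to be decidable: classically this is no restriction,
-- and it makes `Member` a subset in the classical sense.
record NumericalSemigroup : Set₁ where
  field
    Member            : Pred ℕ 0ℓ
    member?           : Decidable Member
    0∈                : 0 ∈ Member
    +-closed          : ∀ {x y} → x ∈ Member → y ∈ Member → x + y ∈ Member
    finite-complement : ∃ (HasCardinality (Subsetoid (setoid ℕ) (∁ Member)))

open NumericalSemigroup public using (Member)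

NumericalSemigroups : Setoid _ _
NumericalSemigroups = On.setoid {B = NumericalSemigroup} (≐-setoid ℕ 0ℓ) Member

genus : NumericalSemigroup → ℕ
genus Λ = proj₁ (NumericalSemigroup.finite-complement Λ)

ContainsAllFrom : NumericalSemigroup → Pred ℕ 0ℓ
ContainsAllFrom Λ c = ∀ {ℓ} → c ≤ ℓ → ℓ ∈ Member Λ

IsConductor : NumericalSemigroup → Pred ℕ 0ℓ
IsConductor Λ c = ContainsAllFrom Λ c × (∀ {c′} → ContainsAllFrom Λ c′ → c ≤ c′)

data ⟨_⟩ (A : Pred ℕ 0ℓ) : Pred ℕ 0ℓ where
  gen  : ∀ {x} → x ∈ A → x ∈ ⟨ A ⟩
  zero : 0 ∈ ⟨ A ⟩
  add  : ∀ {x y} → x ∈ ⟨ A ⟩ → y ∈ ⟨ A ⟩ → x + y ∈ ⟨ A ⟩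

Generates : Pred ℕ 0ℓ → NumericalSemigroup → Set
Generates A Λ = ⟨ A ⟩ ≐ Member Λ

IsMinimalGeneratingSet : Pred ℕ 0ℓ → NumericalSemigroup → Set₁
IsMinimalGeneratingSet A Λ =
  Generates A Λ × (∀ (B : Pred ℕ 0ℓ) → B ⊆ A → Generates B Λ → A ⊆ B)

-- A numerical semigroup has exactly one minimal generating set, so it does
-- not matter which one is taken here.
IsMinimalGenerator : NumericalSemigroup → Pred ℕ _
IsMinimalGenerator Λ x = ∃ λ A → IsMinimalGeneratingSet A Λ × x ∈ A

IsEffectiveGenerator : NumericalSemigroup → Pred ℕ _
IsEffectiveGenerator Λ x =
  IsMinimalGenerator Λ x × ∃ λ c → IsConductor Λ c × c ≤ x

_IsParentOf_ : NumericalSemigroup → NumericalSemigroup → Set₁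
Λ IsParentOf Λ′ =
  ∃ λ x → IsEffectiveGenerator Λ x × Member Λ′ ≐ Member Λ ∖ ｛ x ｝

IsInfiniteChain : (ℕ → NumericalSemigroup) → Set₁
IsInfiniteChain Λ = Member (Λ 0) ≐ U {A = ℕ} × (∀ i → Λ i IsParentOf Λ (suc i))

InInfiniteChain : Pred NumericalSemigroup _
InInfiniteChain Λ =
  ∃ λ chain → IsInfiniteChain chain × ∃ λ i → Member (chain i) ≐ Member Λ

HasGenus : ℕ → Pred NumericalSemigroup 0ℓ
HasGenus g Λ = genus Λ ≡ g

-- n is the number n_g of numerical semigroups of genus g.
CountOfGenus : ℕ → ℕ → Set _
CountOfGenus g n = HasCardinality (Subsetoid NumericalSemigroups (HasGenus g)) n

-- i is the number i_g of those that are in an infinite chain.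
CountInChainsOfGenus : ℕ → ℕ → Set _
CountInChainsOfGenus g i =
  HasCardinality
    (Subsetoid NumericalSemigroups (λ Λ → HasGenus g Λ × InInfiniteChain Λ)) i

{-# OPTIONS --safe #-}

-- Let F be the largest gap of Λ and d the gcd of the elements below F.  Every
-- semigroup that follows Λ in a chain keeps these elements, so if d = 1 then by
-- Bézout they all contain a common interval [N, ∞), and the chain is finite.  If
-- d ≠ 1, removing the non-multiples of d in increasing order extends Λ to an
-- infinite chain.  So Λ is in an infinite chain exactly when d ≠ 1.
--
-- The bound comes from an injection of the semigroups with d ≠ 1 into those
-- with d = 1.  The parent P = Λ ∪ {F} has at most two children with d ≠ 1: they
-- arise by removing the conductor c of P or c + 1.  If m is the multiplicity
-- of P, every non-multiple of d in [c, c + m) is a generator of P, and removing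
-- one beyond c + 1 leaves two consecutive elements below the new largest gap.
-- Such generators can be chosen injectively except when 2 ∈ Λ, and for one
-- family of multiplicity 4.

module Submission where

open import Defs
open import Data.Fin using (Fin; zero; suc; splitAt; join; toℕ; fromℕ<; combine; funToFin; finToFun)
open import Data.Fin.Properties as Finₚ using (toℕ<n; toℕ-injective; toℕ-fromℕ<; fromℕ<-toℕ; fromℕ<-cong; injective⇒≤; join-splitAt)
open import Data.Nat
open import Data.Nat.Divisibility hiding (divides)
open import Data.Nat.DivMod using (_/_; _%_; m≡m%n+[m/n]*n; m%n<n; m*n/n≡m; /-monoˡ-≤)
open import Data.Nat.GCD using (gcd; gcd-GCD; gcd[m,n]∣m; gcd[m,n]∣n; module Bézout)
open import Data.Nat.Induction using (<-rec)
open import Data.Nat.Properties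
open import Data.Product using (Σ; ∃; ∃₂; _×_; _,_; proj₁; proj₂)
open import Data.Sum using (_⊎_; inj₁; inj₂)
open import Data.Unit using (tt)
open import Function.Base using (_∘_; id)
open import Function.Bundles using (Inverse)
open import Level using (Level; 0ℓ)
open import Relation.Binary.Bundles using (Setoid)
open import Relation.Binary.Definitions using (Tri; tri<; tri≈; tri>)
open import Relation.Binary.PropositionalEquality using (_≡_; _≢_; refl; sym; trans; cong; cong₂; subst; setoid; module ≡-Reasoning)
open import Relation.Nullary using (¬_; Dec; yes; no; contradiction)
open import Relation.Nullary.Decidable using (map′; _×-dec_; _⊎-dec_; _→-dec_; ¬?; decidable-stable)
open import Relation.Unary using (Pred; Decidable; ∁; _≐_; _∈_; _∉_; _⊆_)

private variable
  a ℓ p : Level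
  n : ℕ

open NumericalSemigroup using (member?; 0∈; +-closed; finite-complement)

-- Finite sets

enumeration : (S : Setoid a ℓ) → let open Setoid S using (Carrier; _≈_) in
              (to : Fin n → Carrier) →
              (∀ i j → to i ≈ to j → i ≡ j) → (∀ y → ∃ λ i → to i ≈ y) →
              HasCardinality S n
enumeration S to injective surjective = record
  { to        = to
  ; from      = λ y → proj₁ (surjective y)
  ; to-cong   = λ { refl → S.refl }
  ; from-cong = λ {x} {y} x≈y → injective _ _
      (S.trans (proj₂ (surjective x)) (S.trans x≈y (S.sym (proj₂ (surjective y)))))
  ; inverse   = (λ { {x} refl → proj₂ (surjective x) })
              , (λ {x} {y} y≈tox → injective _ _ (S.trans (proj₂ (surjective y)) y≈tox))
  }
  where module S = Setoid S

module _ {S : Setoid a ℓ} (f : HasCardinality S n) where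
  open Setoid S using (_≈_)
  open Inverse f

  to-injective : ∀ {i j} → to i ≈ to j → i ≡ j
  to-injective {i} {j} eq =
    trans (sym (strictlyInverseʳ i)) (trans (from-cong eq) (strictlyInverseʳ j))

  from-injective : ∀ {x y} → from x ≡ from y → x ≈ y
  from-injective {x} {y} eq =
    Setoid.trans S (Setoid.sym S (strictlyInverseˡ x))
      (Setoid.trans S (to-cong eq) (strictlyInverseˡ y))

subset-enumeration : ∀ n {P : Pred (Fin n) p} → Decidable P →
  ∃ λ m → Σ (Fin m → Fin n) λ e →
    (∀ i j → e i ≡ e j → i ≡ j) × (∀ i → P (e i)) × (∀ k → P k → ∃ λ i → e i ≡ k)
subset-enumeration zero P? = 0 , (λ ()) , (λ ()) , (λ ()) , λ ()
subset-enumeration (suc n) P? with subset-enumeration n (P? ∘ suc) | P? zero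
... | m , e , inj , sound , complete | no ¬p =
  m , suc ∘ e , (λ i j eq → inj i j (Finₚ.suc-injective eq)) , sound ,
  λ { zero q → contradiction q ¬p
    ; (suc k) q → let i , eq = complete k q in i , cong suc eq }
... | m , e , inj , sound , complete | yes q₀ =
  suc m , (λ { zero → zero ; (suc i) → suc (e i) }) ,
  (λ { zero zero eq → refl
     ; (suc i) (suc j) eq → cong suc (inj i j (Finₚ.suc-injective eq)) }) ,
  (λ { zero → q₀ ; (suc i) → sound i }) ,
  λ { zero q → zero , refl
    ; (suc k) q → let i , eq = complete k q in suc i , cong suc eq }

-- Constructively a subset of a finite set has a cardinality only if membership in it is decidable;
-- hence the hypothesis that one can decide which codes occur.
finite-image : (S : Setoid a ℓ) → let open Setoid S using (Carrier; _≈_) in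
               (code : Carrier → Fin n) →
               (∀ {x y} → x ≈ y → code x ≡ code y) →
               (∀ {x y} → code x ≡ code y → x ≈ y) →
               (∀ k → Dec (∃ λ x → code x ≡ k)) →
               ∃ (HasCardinality S)
finite-image {n = n} S code code-cong code-inj image?
  with subset-enumeration n image?
... | m , e , inj , sound , complete =
  m , enumeration S (λ i → proj₁ (sound i))
    (λ i j eq → inj i j
      (trans (sym (proj₂ (sound i))) (trans (code-cong eq) (proj₂ (sound j)))))
    λ y → let i , eq = complete (code y) (y , refl) in
          i , code-inj (trans (proj₂ (sound i)) eq)

abstract
  finite-bounded : {P : Pred ℕ p} → Decidable P → ∀ N → (∀ {x} → P x → x < N) →
                   ∃ (HasCardinality (Subsetoid (setoid ℕ) P))
  finite-bounded {P = P} P? N bound =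
    finite-image {n = N} (Subsetoid (setoid ℕ) P) (λ (x , px) → fromℕ< (bound px))
      (λ eq → fromℕ<-cong _ _ eq _ _)
      (λ {x} {y} eq → trans (sym (toℕ-fromℕ< (bound (proj₂ x))))
                        (trans (cong toℕ eq) (toℕ-fromℕ< (bound (proj₂ y)))))
      λ k → map′ (λ q → (toℕ k , q) , fromℕ<-toℕ k _)
                 (λ { ((x , q) , refl) → subst P (sym (toℕ-fromℕ< _)) q })
                 (P? (toℕ k))

-- Gaps and the number of semigroups of a given genus

mkSemigroup : {M : Pred ℕ 0ℓ} → Decidable M → 0 ∈ M →
              (∀ {x y} → x ∈ M → y ∈ M → x + y ∈ M) →
              ∀ N → (∀ {x} → N ≤ x → x ∈ M) → NumericalSemigroup
mkSemigroup {M} M? 0∈M closed N all = record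
  { Member            = M
  ; member?           = M?
  ; 0∈                = 0∈M
  ; +-closed          = closed
  ; finite-complement = finite-bounded (λ x → ¬? (M? x)) N (λ x∉ → ≰⇒> (x∉ ∘ all))
  }

module _ (Λ : NumericalSemigroup) where
  private module C = Inverse (proj₂ (finite-complement Λ))

  gap : Fin (genus Λ) → ℕ
  gap i = proj₁ (C.to i)

  gap∉ : ∀ i → gap i ∉ Member Λ
  gap∉ i = proj₂ (C.to i)

  gap-injective : ∀ {i j} → gap i ≡ gap j → i ≡ j
  gap-injective = to-injective (proj₂ (finite-complement Λ))

  gap-surjective : ∀ {x} → x ∉ Member Λ → ∃ λ i → gap i ≡ x
  gap-surjective x∉ = C.from (_ , x∉) , C.strictlyInverseˡ (_ , x∉)

  gaps≤genus : (f : Fin n → ℕ) → (∀ {i j} → f i ≡ f j → i ≡ j) →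
               (∀ i → f i ∉ Member Λ) → n ≤ genus Λ
  gaps≤genus f f-inj f∉ = injective⇒≤ {f = λ i → proj₁ (gap-surjective (f∉ i))} λ {i} {j} eq →
    f-inj (trans (sym (proj₂ (gap-surjective (f∉ i))))
            (trans (cong gap eq) (proj₂ (gap-surjective (f∉ j)))))

  positive-nonmember : ∀ {x} → x ∉ Member Λ → 0 < x
  positive-nonmember {zero}  0∉ = contradiction (0∈ Λ) 0∉
  positive-nonmember {suc x} _  = z<s

  -- All gaps lie in [1, F], because 0 is a member; `pred` moves them into [0, F).
  genus≤ : ∀ {F} → (∀ {x} → F < x → x ∈ Member Λ) → genus Λ ≤ F
  genus≤ {F} all = injective⇒≤ {f = λ i → fromℕ< (below i)} λ {i} {j} eq →
    gap-injective (pred-inj (positive-nonmember (gap∉ i)) (positive-nonmember (gap∉ j))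
      (trans (sym (toℕ-fromℕ< (below i))) (trans (cong toℕ eq) (toℕ-fromℕ< (below j)))))
    where
    pred-inj : ∀ {x y} → 0 < x → 0 < y → pred x ≡ pred y → x ≡ y
    pred-inj {suc x} {suc y} _ _ refl = refl
    pred-below : ∀ {x} → 0 < x → x ≤ F → pred x < F
    pred-below {suc x} _ x≤F = x≤F
    below : ∀ i → pred (gap i) < F
    below i = pred-below (positive-nonmember (gap∉ i)) (≮⇒≥ (gap∉ i ∘ all))

  -- If x is a gap then so is k or x ∸ k for every k ≤ x, which gives more
  -- than genus Λ gaps when x is at least twice the genus.
  contains-twice-genus : ∀ {x} → genus Λ + genus Λ ≤ x → x ∈ Member Λ
  contains-twice-genus {x} 2g≤x with member? Λ x
  ... | yes x∈ = x∈
  ... | no x∉ = contradiction (gaps≤genus f f-inj f∉) 1+n≰n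
    where
    f : Fin (suc (genus Λ)) → ℕ
    f i with member? Λ (toℕ i)
    ... | yes _ = x ∸ toℕ i
    ... | no _  = toℕ i
    i≤g : ∀ i → toℕ {suc (genus Λ)} i ≤ genus Λ
    i≤g i = s≤s⁻¹ (toℕ<n i)
    i≤x : ∀ i → toℕ {suc (genus Λ)} i ≤ x
    i≤x i = ≤-trans (i≤g i) (≤-trans (m≤m+n _ _) 2g≤x)
    f∉ : ∀ i → f i ∉ Member Λ
    f∉ i with member? Λ (toℕ i)
    ... | yes i∈ = λ x∸i∈ → x∉ (subst (Member Λ) (m+[n∸m]≡n (i≤x i)) (+-closed Λ i∈ x∸i∈))
    ... | no i∉  = i∉
    complementary : ∀ i j → x ∸ toℕ i ≡ toℕ j → i ≡ j
    complementary i j eq = toℕ-injective (trans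
      (≤-antisym (i≤g i) (+-cancelʳ-≤ (genus Λ) _ _
        (≤-trans (≤-trans 2g≤x (≤-reflexive (sym x≡))) (+-monoʳ-≤ (toℕ i) (i≤g j)))))
      (sym (≤-antisym (i≤g j) (+-cancelˡ-≤ (genus Λ) _ _
        (≤-trans (≤-trans 2g≤x (≤-reflexive (sym x≡))) (+-monoˡ-≤ (toℕ j) (i≤g i)))))))
      where
      x≡ : toℕ i + toℕ j ≡ x
      x≡ = trans (cong (toℕ i +_) (sym eq)) (m+[n∸m]≡n (i≤x i))
    f-inj : ∀ {i j} → f i ≡ f j → i ≡ j
    f-inj {i} {j} eq with member? Λ (toℕ i) | member? Λ (toℕ j)
    ... | yes _ | yes _ = toℕ-injective (∸-cancelˡ-≡ (i≤x i) (i≤x j) eq)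
    ... | yes _ | no _  = complementary i j eq
    ... | no _  | yes _ = sym (complementary j i (sym eq))
    ... | no _  | no _  = toℕ-injective eq

  conductor : ∀ N → ContainsAllFrom Λ N → ∃ λ c → IsConductor Λ c × c ≤ N
  conductor zero    all = 0 , (all , λ _ → z≤n) , z≤n
  conductor (suc N) all with member? Λ N
  ... | yes N∈ = let c , c-cond , c≤N = conductor N all′ in c , c-cond , m≤n⇒m≤1+n c≤N
    where
    all′ : ContainsAllFrom Λ N
    all′ N≤x with m≤n⇒m<n∨m≡n N≤x
    ... | inj₁ N<x  = all N<x
    ... | inj₂ refl = N∈
  ... | no N∉  = suc N , (all , λ all′ → ≰⇒> (N∉ ∘ all′)) , ≤-refl

-- An element of `Λ` outside `Λ′` would be one more gap of `Λ′` besides all the gaps of `Λ`.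
⊆-same-genus : ∀ {Λ Λ′} → Member Λ′ ⊆ Member Λ → genus Λ ≡ genus Λ′ → Member Λ ⊆ Member Λ′
⊆-same-genus {Λ} {Λ′} Λ′⊆Λ eq {x} x∈ with member? Λ′ x
... | yes x∈′ = x∈′
... | no x∉  = contradiction (subst (suc (genus Λ) ≤_) (sym eq) (gaps≤genus Λ′ f (f-inj _ _) f∉)) 1+n≰n
  where
  f : Fin (suc (genus Λ)) → ℕ
  f zero    = x
  f (suc i) = gap Λ i
  f∉ : ∀ i → f i ∉ Member Λ′
  f∉ zero    = x∉
  f∉ (suc i) = gap∉ Λ i ∘ Λ′⊆Λ
  f-inj : ∀ i j → f i ≡ f j → i ≡ j
  f-inj zero    zero    _    = refl
  f-inj zero    (suc j) refl = contradiction x∈ (gap∉ Λ j)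
  f-inj (suc i) zero    refl = contradiction x∈ (gap∉ Λ i)
  f-inj (suc i) (suc j) eq′  = cong suc (gap-injective Λ eq′)

≐⇒genus≡ : ∀ {Λ Λ′} → Member Λ ≐ Member Λ′ → genus Λ ≡ genus Λ′
≐⇒genus≡ {Λ} {Λ′} (⊆₁ , ⊆₂) = ≤-antisym
  (gaps≤genus Λ′ (gap Λ) (gap-injective Λ) λ i → gap∉ Λ i ∘ ⊆₂)
  (gaps≤genus Λ (gap Λ′) (gap-injective Λ′) λ i → gap∉ Λ′ i ∘ ⊆₁)

record IsFrobenius (Λ : NumericalSemigroup) (F : ℕ) : Set where
  field
    F∉     : F ∉ Member Λ
    above∈ : ∀ {x} → F < x → x ∈ Member Λ

frobenius : ∀ Λ → 0 < genus Λ → ∃ (IsFrobenius Λ)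
frobenius Λ 0<g with conductor Λ _ (contains-twice-genus Λ)
... | zero  , (all , _) , _     = contradiction (all z≤n) (gap∉ Λ (fromℕ< 0<g))
... | suc F , (all , least) , _ = F , record { F∉ = F∉ ; above∈ = all }
  where
  F∉ : F ∉ Member Λ
  F∉ F∈ = 1+n≰n (least λ F≤x → case-≤ (m≤n⇒m<n∨m≡n F≤x))
    where
    case-≤ : ∀ {x} → F < x ⊎ F ≡ x → x ∈ Member Λ
    case-≤ (inj₁ F<x)  = all F<x
    case-≤ (inj₂ refl) = F∈

-- Enumeration of the semigroups of a fixed genus

module OfGenus (g : ℕ) where

  private N = g + g

  SemigroupsOfGenus : Setoid _ _
  SemigroupsOfGenus = Subsetoid NumericalSemigroups (HasGenus g)

  bit : {A : Set} → Dec A → Fin 2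
  bit (yes _) = suc zero
  bit (no _)  = zero

  bit-cong : ∀ {A B : Set} {A? : Dec A} {B? : Dec B} → (A → B) → (B → A) → bit A? ≡ bit B?
  bit-cong {A? = yes _} {yes _} _ _ = refl
  bit-cong {A? = yes a} {no ¬b} f _ = contradiction (f a) ¬b
  bit-cong {A? = no ¬a} {yes b} _ g = contradiction (g b) ¬a
  bit-cong {A? = no _}  {no _}  _ _ = refl

  bit-inj : ∀ {A B : Set} {A? : Dec A} {B? : Dec B} → bit A? ≡ bit B? → A → B
  bit-inj {A? = yes _} {yes b} _  _ = b
  bit-inj {A? = no ¬a}         _  a = contradiction a ¬a

  funToFin-cong : ∀ {m n} {f h : Fin m → Fin n} → (∀ i → f i ≡ h i) → funToFin f ≡ funToFin h
  funToFin-cong {zero}  eq = refl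
  funToFin-cong {suc m} eq = cong₂ combine (eq zero) (funToFin-cong (eq ∘ suc))

  bits : NumericalSemigroup → Fin N → Fin 2
  bits Λ i = bit (member? Λ (toℕ i))

  -- By `contains-twice-genus` a semigroup of genus `g` contains everything from `N` = 2g on, so its
  -- membership bits below `N` determine it.
  code : NumericalSemigroup → Fin (2 ^ N)
  code Λ = funToFin (bits Λ)

  code-cong : ∀ {Λ Λ′} → Member Λ ≐ Member Λ′ → code Λ ≡ code Λ′
  code-cong {Λ} {Λ′} (⊆₁ , ⊆₂) = funToFin-cong {N} {2} λ i →
    bit-cong {A? = member? Λ (toℕ i)} {member? Λ′ (toℕ i)} ⊆₁ ⊆₂

  -- From `N` on membership holds vacuously, as it must in a semigroup of genus `g`.
  Coded : Fin (2 ^ N) → Pred ℕ 0ℓ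
  Coded k x = (x<N : x < N) → finToFun {2} {N} k (fromℕ< x<N) ≡ suc zero

  coded? : ∀ k → Decidable (Coded k)
  coded? k x with x <? N
  ... | no x≮N = yes λ x<N → contradiction x<N x≮N
  ... | yes x<N = map′ (λ eq _ → eq) (λ f → f x<N) (_ Finₚ.≟ _)

  coded-above : ∀ k {x} → N ≤ x → x ∈ Coded k
  coded-above k N≤x x<N = contradiction N≤x (<⇒≱ x<N)

  code≡⇒≐ : ∀ {Λ k} → genus Λ ≡ g → code Λ ≡ k → Member Λ ≐ Coded k
  code≡⇒≐ {Λ} g≡ refl = ⊆₁ , ⊆₂
    where
    k = code Λ
    bits≡ : ∀ {x} (x<N : x < N) → finToFun k (fromℕ< x<N) ≡ bit (member? Λ x)
    bits≡ x<N = trans (Finₚ.finToFun-funToFin (bits Λ) (fromℕ< x<N))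
                  (cong (bit ∘ member? Λ) (toℕ-fromℕ< x<N))
    ⊆₁ : Member Λ ⊆ Coded k
    ⊆₁ {x} x∈ x<N = trans (bits≡ x<N) (bit-cong {A? = member? Λ x} {yes x∈} id id)
    ⊆₂ : Coded k ⊆ Member Λ
    ⊆₂ {x} h with x <? N
    ... | yes x<N = bit-inj {A? = yes x<N} {member? Λ x} (trans (sym (h x<N)) (bits≡ x<N)) x<N
    ... | no x≮N  = contains-twice-genus Λ (subst (λ h → h + h ≤ x) (sym g≡) (≮⇒≥ x≮N))

  ≐⇒code≡ : ∀ {Λ k} → Member Λ ≐ Coded k → code Λ ≡ k
  ≐⇒code≡ {Λ} {k} (⊆₁ , ⊆₂) = trans (funToFin-cong {N} {2} bits≡) (Finₚ.funToFin-finToFin {N} {2} k)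
    where
    bits≡ : ∀ i → bits Λ i ≡ finToFun k i
    bits≡ i with member? Λ (toℕ i)
    ... | yes i∈ = sym (subst (λ j → finToFun k j ≡ suc zero) (fromℕ<-toℕ i (toℕ<n i)) (⊆₁ i∈ (toℕ<n i)))
    ... | no i∉ with finToFun k i in eq
    ...   | zero = refl
    ...   | suc zero = contradiction
             (⊆₂ λ i<N → trans (cong (finToFun k) (fromℕ<-toℕ i i<N)) eq) i∉

  closed? : ∀ k → Dec (∀ {x} → x < N → ∀ {y} → y < N → Coded k x → Coded k y → Coded k (x + y))
  closed? k = allUpTo? (λ x → allUpTo? (λ y → coded? k x →-dec coded? k y →-dec coded? k (x + y)) N) N

  -- Not every code comes from a semigroup of genus `g`. Sums with a summand from `N` on are members
  -- anyway, so closure is a finite check; after it only the genus remains to be compared.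
  decode : ∀ k → Dec (∃ λ (Λ : Setoid.Carrier SemigroupsOfGenus) → code (proj₁ Λ) ≡ k)
  decode k with coded? k 0 | closed? k
  ... | no 0∉ | _ = no λ { ((Λ , g≡) , eq) → 0∉ (proj₁ (code≡⇒≐ {Λ} g≡ eq) (0∈ Λ)) }
  ... | yes _ | no ¬closed = no λ { ((Λ , g≡) , eq) → ¬closed
          (λ _ _ x∈ y∈ → let ⊆₁ , ⊆₂ = code≡⇒≐ {Λ} g≡ eq in ⊆₁ (+-closed Λ (⊆₂ x∈) (⊆₂ y∈))) }
  ... | yes 0∈′ | yes closed = finish (genus Λ ≟ g)
    where
    closed′ : ∀ {x y} → Coded k x → Coded k y → Coded k (x + y)
    closed′ {x} {y} x∈ y∈ with x <? N | y <? N
    ... | yes x<N | yes y<N = closed x<N y<N x∈ y∈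
    ... | no x≮N  | _       = coded-above k (≤-trans (≮⇒≥ x≮N) (m≤m+n x y))
    ... | yes _   | no y≮N  = coded-above k (≤-trans (≮⇒≥ y≮N) (m≤n+m y x))
    Λ : NumericalSemigroup
    Λ = mkSemigroup (coded? k) 0∈′ closed′ N (coded-above k)
    finish : Dec (genus Λ ≡ g) → Dec (∃ λ (Λ : Setoid.Carrier SemigroupsOfGenus) → code (proj₁ Λ) ≡ k)
    finish (yes g≡) = yes ((Λ , g≡) , ≐⇒code≡ {Λ} (id , id))
    finish (no g≢)  = no λ { ((Λ′ , g≡) , eq) →
      g≢ (trans (sym (≐⇒genus≡ {Λ′} {Λ} (code≡⇒≐ {Λ′} g≡ eq))) g≡) }

  abstract
    count-of-genus : ∃ (CountOfGenus g)
    count-of-genus = finite-image SemigroupsOfGenus (code ∘ proj₁)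
      (λ {x} {y} → code-cong {proj₁ x} {proj₁ y})
      (λ {x} {y} eq →
        let a₁ , a₂ = code≡⇒≐ {proj₁ x} (proj₂ x) eq
            b₁ , b₂ = code≡⇒≐ {proj₁ y} (proj₂ y) refl in
        b₂ ∘ a₁ , a₂ ∘ b₁)
      decode

  abstract
    count-in-chains : (∀ Λ → HasGenus g Λ → Dec (InInfiniteChain Λ)) → ∃ (CountInChainsOfGenus g)
    count-in-chains chain? with count-of-genus
    ... | n , f = finite-image (Subsetoid NumericalSemigroups (λ Λ → HasGenus g Λ × InInfiniteChain Λ))
      (λ (Λ , g≡ , _) → from (Λ , g≡)) from-cong (from-injective f) image?
      where
      open Inverse f
      image? : ∀ k → Dec (∃ λ (Λ : Σ NumericalSemigroup λ Λ → HasGenus g Λ × InInfiniteChain Λ) →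
                 from (proj₁ Λ , proj₁ (proj₂ Λ)) ≡ k)
      image? k with chain? (proj₁ (to k)) (proj₂ (to k))
      ... | yes c = yes ((proj₁ (to k) , proj₂ (to k) , c) , strictlyInverseʳ k)
      ... | no ¬c = no λ { ((Λ , g≡ , chain , isChain , i , (⊆₁ , ⊆₂)) , eq) →
              let s₁ , s₂ = from-injective f {Λ , g≡} {to k} (trans eq (sym (strictlyInverseʳ k)))
              in ¬c (chain , isChain , i , (s₁ ∘ ⊆₁ , ⊆₂ ∘ s₂)) }

-- Minimal generators and infinite chains

least : {P : Pred ℕ p} → Decidable P → ∀ {n} → P n → ∃ λ m → P m × (∀ {k} → k < m → ¬ P k)
least {P = P} P? {n} Pn with below (suc n)
  where
  below : ∀ N → (∀ {k} → k < N → ¬ P k) ⊎ ∃ λ m → P m × (∀ {k} → k < m → ¬ P k)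
  below zero = inj₁ λ ()
  below (suc N) with below N | P? N
  ... | inj₂ m   | _      = inj₂ m
  ... | inj₁ all | yes PN = inj₂ (N , PN , all)
  ... | inj₁ all | no ¬PN = inj₁ λ k<1+N Pk → case k<1+N Pk (m≤n⇒m<n∨m≡n (s≤s⁻¹ k<1+N))
    where
    case : ∀ {k} → k < suc N → P k → ¬ (k < N ⊎ k ≡ N)
    case _ Pk (inj₁ k<N)  = all k<N Pk
    case _ Pk (inj₂ refl) = ¬PN Pk
... | inj₁ none = contradiction Pn (none ≤-refl)
... | inj₂ m    = m

module _ (Λ : NumericalSemigroup) where

  Irreducible : Pred ℕ 0ℓ
  Irreducible x = x ∈ Member Λ × x ≢ 0 ×
    (∀ {y z} → y ∈ Member Λ → z ∈ Member Λ → y ≢ 0 → z ≢ 0 → y + z ≢ x)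

  reducible? : ∀ x → Dec (∃ λ y → y < x × (y ∈ Member Λ × y ≢ 0 × x ∸ y ∈ Member Λ))
  reducible? x = anyUpTo? (λ y → member? Λ y ×-dec ¬? (y ≟ 0) ×-dec member? Λ (x ∸ y)) x

  ⟨⟩⊆ : {A : Pred ℕ 0ℓ} → A ⊆ Member Λ → ⟨ A ⟩ ⊆ Member Λ
  ⟨⟩⊆ A⊆ (gen x∈)    = A⊆ x∈
  ⟨⟩⊆ A⊆ zero        = 0∈ Λ
  ⟨⟩⊆ A⊆ (add x∈ y∈) = +-closed Λ (⟨⟩⊆ A⊆ x∈) (⟨⟩⊆ A⊆ y∈)

  irreducibles-generate : Member Λ ⊆ ⟨ Irreducible ⟩
  irreducibles-generate {x} = <-rec (λ x → x ∈ Member Λ → x ∈ ⟨ Irreducible ⟩) step x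
    where
    step : ∀ x → (∀ {y} → y < x → y ∈ Member Λ → y ∈ ⟨ Irreducible ⟩) →
           x ∈ Member Λ → x ∈ ⟨ Irreducible ⟩
    step zero    _   _  = zero
    step x@(suc _) rec x∈ with reducible? x
    ... | yes (y , y<x , y∈ , y≢0 , x∸y∈) =
      subst ⟨ Irreducible ⟩ (m+[n∸m]≡n (<⇒≤ y<x))
        (add (rec y<x y∈) (rec (∸-monoʳ-< (n≢0⇒n>0 y≢0) (<⇒≤ y<x)) x∸y∈))
    ... | no ¬red = gen (x∈ , (λ ()) , λ {y} {z} y∈ z∈ y≢0 z≢0 y+z≡x → ¬red
          ( y , subst (y <_) y+z≡x (m<m+n y (n≢0⇒n>0 z≢0)) , y∈ , y≢0
          , subst (Member Λ) (trans (sym (m+n∸m≡n y z)) (cong (_∸ y) y+z≡x)) z∈))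

  -- A derivation of an irreducible element cannot end in a sum of two nonzero elements, so up to
  -- added zeros it is a single `gen`. Hence every generating set contains the irreducible elements.
  irreducible-generator : {B : Pred ℕ 0ℓ} → B ⊆ Member Λ → ∀ {x} → x ∈ Irreducible → x ∈ ⟨ B ⟩ → x ∈ B
  irreducible-generator B⊆ _ (gen x∈) = x∈
  irreducible-generator B⊆ (_ , 0≢0 , _) zero = contradiction refl 0≢0
  irreducible-generator {B} B⊆ irr@(_ , _ , irred) (add {y} {z} y∈ z∈) with y ≟ 0 | z ≟ 0
  ... | yes refl | _ = irreducible-generator B⊆ irr z∈
  ... | no _ | yes refl = subst B (sym (+-identityʳ y))
        (irreducible-generator B⊆ (subst Irreducible (+-identityʳ y) irr) y∈)
  ... | no y≢0 | no z≢0 = contradiction refl (irred (⟨⟩⊆ B⊆ y∈) (⟨⟩⊆ B⊆ z∈) y≢0 z≢0)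

  irreducible⇒minimal-generator : ∀ {x} → x ∈ Irreducible → IsMinimalGenerator Λ x
  irreducible⇒minimal-generator irr =
    Irreducible ,
    ( (⟨⟩⊆ proj₁ , irreducibles-generate)
    , λ B B⊆ (_ , generates) irr′ → irreducible-generator (proj₁ ∘ B⊆) irr′ (generates (proj₁ irr′))) ,
    irr

-- An infinite chain whose members have the submonoid M as their intersection:
-- its i-th member adds to M everything from the i-th gap of M on.
module ChainTo {M : Pred ℕ 0ℓ} (M? : Decidable M) (0∈M : 0 ∈ M)
  (closed : ∀ {x y} → x ∈ M → y ∈ M → x + y ∈ M)
  (unbounded : ∀ n → ∃ λ k → n ≤ k × k ∉ M) where

  next : ∀ n → ∃ λ m → (n ≤ m × m ∉ M) × (∀ {k} → k < m → ¬ (n ≤ k × k ∉ M))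
  next n = least (λ k → n ≤? k ×-dec ¬? (M? k)) (proj₂ (unbounded n))

  nextGap : ℕ → ℕ
  nextGap n = proj₁ (next n)

  ≤nextGap : ∀ n → n ≤ nextGap n
  ≤nextGap n = proj₁ (proj₁ (proj₂ (next n)))

  nextGap∉ : ∀ n → nextGap n ∉ M
  nextGap∉ n = proj₂ (proj₁ (proj₂ (next n)))

  <nextGap⇒∈ : ∀ n {k} → n ≤ k → k < nextGap n → k ∈ M
  <nextGap⇒∈ n {k} n≤k k< = decidable-stable (M? k) λ k∉ → proj₂ (proj₂ (next n)) k< (n≤k , k∉)

  gapAt : ℕ → ℕ
  gapAt zero    = nextGap 0
  gapAt (suc i) = nextGap (suc (gapAt i))

  gapAt∉ : ∀ i → gapAt i ∉ M
  gapAt∉ zero    = nextGap∉ 0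
  gapAt∉ (suc i) = nextGap∉ (suc (gapAt i))

  gapAt-suc : ∀ i → gapAt i < gapAt (suc i)
  gapAt-suc i = ≤nextGap (suc (gapAt i))

  MemberFrom : ℕ → Pred ℕ 0ℓ
  MemberFrom n x = x ∈ M ⊎ n ≤ x

  memberFrom-closed : ∀ n {x y} → x ∈ MemberFrom n → y ∈ MemberFrom n → x + y ∈ MemberFrom n
  memberFrom-closed n (inj₁ x∈) (inj₁ y∈) = inj₁ (closed x∈ y∈)
  memberFrom-closed n {x} {y} (inj₂ n≤x) _ = inj₂ (≤-trans n≤x (m≤m+n x y))
  memberFrom-closed n {x} {y} _ (inj₂ n≤y) = inj₂ (≤-trans n≤y (m≤n+m y x))

  chain : ℕ → NumericalSemigroup
  chain i = mkSemigroup (λ x → M? x ⊎-dec (gapAt i ≤? x)) (inj₁ 0∈M)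
              (memberFrom-closed (gapAt i)) (gapAt i) inj₂

  gapAt≢0 : ∀ i → gapAt i ≢ 0
  gapAt≢0 i eq = gapAt∉ i (subst M (sym eq) 0∈M)

  -- A sum of two elements of `M` stays in `M`, which misses the gap, and a nonzero number added to
  -- one at or above the gap exceeds it.
  gapAt-irreducible : ∀ i → gapAt i ∈ Irreducible (chain i)
  gapAt-irreducible i = inj₂ ≤-refl , gapAt≢0 i , irreducible
    where
    irreducible : ∀ {y z} → y ∈ MemberFrom (gapAt i) → z ∈ MemberFrom (gapAt i) →
                  y ≢ 0 → z ≢ 0 → y + z ≢ gapAt i
    irreducible (inj₁ y∈) (inj₁ z∈) _ _ eq = gapAt∉ i (subst M eq (closed y∈ z∈))
    irreducible {y} {z} (inj₂ a≤y) _ _ z≢0 eq =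
      <⇒≱ (subst (y <_) eq (m<m+n y (n≢0⇒n>0 z≢0))) a≤y
    irreducible {y} {z} _ (inj₂ a≤z) y≢0 _ eq =
      <⇒≱ (subst (z <_) eq (m<n+m z (n≢0⇒n>0 y≢0))) a≤z

  isInfiniteChain : IsInfiniteChain chain
  isInfiniteChain = ((λ _ → tt) , λ {x} _ → start x) , λ i →
    gapAt i ,
    ( irreducible⇒minimal-generator (chain i) (gapAt-irreducible i)
    , conductor (chain i) (gapAt i) inj₂) ,
    ( (λ { (inj₁ x∈) → inj₁ x∈ , λ { refl → gapAt∉ i x∈ }
         ; (inj₂ a≤x) → inj₂ (≤-trans (<⇒≤ (gapAt-suc i)) a≤x) , λ { refl → <⇒≱ (gapAt-suc i) a≤x } })
    , λ { (inj₁ x∈ , _)     → inj₁ x∈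
        ; (inj₂ a≤x , a≢x) → above i (≤∧≢⇒< a≤x a≢x) })
    where
    start : ∀ x → x ∈ MemberFrom (gapAt 0)
    start x with gapAt 0 ≤? x
    ... | yes a≤x = inj₂ a≤x
    ... | no a≰x  = inj₁ (<nextGap⇒∈ 0 z≤n (≰⇒> a≰x))
    above : ∀ i {x} → gapAt i < x → x ∈ MemberFrom (gapAt (suc i))
    above i {x} a<x with gapAt (suc i) ≤? x
    ... | yes a≤x = inj₂ a≤x
    ... | no a≰x  = inj₁ (<nextGap⇒∈ (suc (gapAt i)) a<x (≰⇒> a≰x))

  locate : ∀ n → n < gapAt 0 ⊎ ∃ λ i → gapAt i ≤ n × n < gapAt (suc i)
  locate zero with gapAt 0 ≤? 0
  ... | yes a≤0 = contradiction (n≤0⇒n≡0 a≤0) (gapAt≢0 0)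
  ... | no a≰0  = inj₁ (≰⇒> a≰0)
  locate (suc n) with locate n
  ... | inj₁ n<a with gapAt 0 ≤? suc n
  ...   | yes a≤ = inj₂ (0 , a≤ , ≤-<-trans n<a (gapAt-suc 0))
  ...   | no a≰  = inj₁ (≰⇒> a≰)
  locate (suc n) | inj₂ (i , a≤n , n<a) with gapAt (suc i) ≤? suc n
  ...   | yes a≤ = inj₂ (suc i , a≤ , ≤-<-trans n<a (gapAt-suc (suc i)))
  ...   | no a≰  = inj₂ (i , m≤n⇒m≤1+n a≤n , ≰⇒> a≰)

  -- `M` has no gap strictly between `gapAt i` and `gapAt (suc i)`. With `i` chosen so that `F` lies
  -- in this range, `Λ` and `chain (suc i)` agree: both are `M` up to `F` and contain everything
  -- above it.
  inInfiniteChain : ∀ Λ {F} → F ∉ M → (∀ {x} → x ≤ F → x ∈ Member Λ → x ∈ M) → M ⊆ Member Λ →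
                    (∀ {x} → F < x → x ∈ Member Λ) → InInfiniteChain Λ
  inInfiniteChain Λ {F} F∉ below M⊆ above with locate F
  ... | inj₁ F<a = contradiction (<nextGap⇒∈ 0 z≤n F<a) F∉
  ... | inj₂ (i , a≤F , F<a) = chain , isInfiniteChain , suc i ,
    (λ { (inj₁ x∈) → M⊆ x∈ ; (inj₂ a≤x) → above (<-≤-trans F<a a≤x) }) , ⊆₂
    where
    ⊆₂ : Member Λ ⊆ MemberFrom (gapAt (suc i))
    ⊆₂ {x} x∈ with gapAt (suc i) ≤? x | F <? x
    ... | yes a≤x | _       = inj₂ a≤x
    ... | no a≰x  | yes F<x = inj₁ (<nextGap⇒∈ (suc (gapAt i)) (≤-<-trans a≤F F<x) (≰⇒> a≰x))
    ... | no _    | no F≮x  = inj₁ (below (≮⇒≥ F≮x) x∈)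

-- Submonoids generated by a set: Bézout combinations and cofiniteness

⟨⟩-multiple : {A : Pred ℕ 0ℓ} → ∀ k {x} → x ∈ ⟨ A ⟩ → k * x ∈ ⟨ A ⟩
⟨⟩-multiple zero    x∈ = zero
⟨⟩-multiple (suc k) x∈ = add x∈ (⟨⟩-multiple k x∈)

-- Bézout over ℕ: a common divisor that is a difference of two elements
-- generated by A.
bézout : {A : Pred ℕ 0ℓ} → Decidable A → ∀ N →
         ∃ λ d → (∀ {x} → x < N → x ∈ A → d ∣ x) × ∃ λ v → v ∈ ⟨ A ⟩ × d + v ∈ ⟨ A ⟩
bézout A? zero = 0 , (λ ()) , 0 , zero , zero
bézout {A} A? (suc N) with bézout A? N | A? N
... | d , divides , vs | no N∉ = d , divides′ , vs
  where
  divides′ : ∀ {x} → x < suc N → x ∈ A → d ∣ x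
  divides′ x<1+N x∈ with m≤n⇒m<n∨m≡n (s≤s⁻¹ x<1+N)
  ... | inj₁ x<N  = divides x<N x∈
  ... | inj₂ refl = contradiction x∈ N∉
... | d , divides , v , v∈ , d+v∈ | yes N∈ = gcd d N , divides′ , combination (Bézout.identity (gcd-GCD d N))
  where
  divides′ : ∀ {x} → x < suc N → x ∈ A → gcd d N ∣ x
  divides′ x<1+N x∈ with m≤n⇒m<n∨m≡n (s≤s⁻¹ x<1+N)
  ... | inj₁ x<N  = ∣-trans (gcd[m,n]∣m d N) (divides x<N x∈)
  ... | inj₂ refl = gcd[m,n]∣n d N
  -- `d` itself need not be generated; each multiple `x * d` enters as the difference of the
  -- generated elements `x * (d + v)` and `x * v`.
  regroup : ∀ e x y → e + y * N ≡ x * d → e + (y * N + x * v) ≡ x * (d + v)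
  regroup e x y eq = trans (sym (+-assoc e _ _))
    (trans (cong (_+ x * v) eq) (sym (*-distribˡ-+ x d v)))
  regroup′ : ∀ e x y → e + x * d ≡ y * N → e + x * (d + v) ≡ y * N + x * v
  regroup′ e x y eq = trans (cong (e +_) (*-distribˡ-+ x d v))
    (trans (sym (+-assoc e _ _)) (cong (_+ x * v) eq))
  combination : Bézout.Identity (gcd d N) d N → ∃ λ w → w ∈ ⟨ A ⟩ × gcd d N + w ∈ ⟨ A ⟩
  combination (Bézout.+- x y eq) = y * N + x * v ,
    add (⟨⟩-multiple y (gen N∈)) (⟨⟩-multiple x v∈) ,
    subst ⟨ A ⟩ (sym (regroup _ x y eq)) (⟨⟩-multiple x d+v∈)
  combination (Bézout.-+ x y eq) = x * (d + v) , ⟨⟩-multiple x d+v∈ ,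
    subst ⟨ A ⟩ (sym (regroup′ _ x y eq)) (add (⟨⟩-multiple y (gen N∈)) (⟨⟩-multiple x v∈))

∣-⟨⟩ : {A : Pred ℕ 0ℓ} → ∀ {d} → (∀ {x} → x ∈ A → d ∣ x) → ∀ {x} → x ∈ ⟨ A ⟩ → d ∣ x
∣-⟨⟩ d∣ (gen x∈)    = d∣ x∈
∣-⟨⟩ d∣ zero        = _ ∣0
∣-⟨⟩ d∣ (add x∈ y∈) = ∣m∣n⇒∣m+n (∣-⟨⟩ d∣ x∈) (∣-⟨⟩ d∣ y∈)

-- Write n = q v + r with r < v. For n ≥ v² the quotient q is at least v, so q - r ≥ 0 and n = (q -
-- r) v + r (v + 1).
consecutive⇒cofinite : {A : Pred ℕ 0ℓ} → ∀ {v} → v ∈ ⟨ A ⟩ → suc v ∈ ⟨ A ⟩ →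
                       ∀ {n} → v * v ≤ n → n ∈ ⟨ A ⟩
consecutive⇒cofinite {A} {zero} _ 1∈ {n} _ = subst ⟨ A ⟩ (*-identityʳ n) (⟨⟩-multiple n 1∈)
consecutive⇒cofinite {A} {v@(suc _)} v∈ 1+v∈ {n} v²≤n =
  subst ⟨ A ⟩ eq (add (⟨⟩-multiple (q ∸ r) v∈) (⟨⟩-multiple r 1+v∈))
  where
  q = n / v
  r = n % v
  v≤q : v ≤ q
  v≤q = subst (_≤ q) (m*n/n≡m v v) (/-monoˡ-≤ v v²≤n)
  open ≡-Reasoning
  eq : (q ∸ r) * v + r * suc v ≡ n
  eq = begin
    (q ∸ r) * v + r * suc v     ≡⟨ cong ((q ∸ r) * v +_) (trans (*-suc r v) (+-comm r (r * v))) ⟩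
    (q ∸ r) * v + (r * v + r)   ≡⟨ +-assoc ((q ∸ r) * v) (r * v) r ⟨
    (q ∸ r) * v + r * v + r     ≡⟨ cong (_+ r) (*-distribʳ-+ v (q ∸ r) r) ⟨
    (q ∸ r + r) * v + r         ≡⟨ cong (λ k → k * v + r) (m∸n+n≡m (≤-trans (<⇒≤ (m%n<n n v)) v≤q)) ⟩
    q * v + r                   ≡⟨ +-comm (q * v) r ⟩
    r + q * v                   ≡⟨ m≡m%n+[m/n]*n n v ⟨
    n ∎

-- The gcd of the small elements and the chain criterion

∣-consecutive : ∀ {d n} → d ∣ n → d ∣ suc n → d ≡ 1
∣-consecutive {d} {n} d∣n d∣1+n = ∣1⇒≡1 (∣m+n∣m⇒∣n (subst (d ∣_) (+-comm 1 n) d∣1+n) d∣n)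

-- Being below some gap means being below the largest one; in this form the notion passes along a
-- chain without naming the largest gaps of its members.
Small : NumericalSemigroup → Pred ℕ 0ℓ
Small Λ x = x ∈ Member Λ × ∃ λ y → x < y × y ∉ Member Λ

-- The gcd is 0 when 0 is the only small element, so the condition `d ≢ 1` covers that case as well.
record IsSmallGcd (Λ : NumericalSemigroup) (d : ℕ) : Set where
  field
    divides  : ∀ {x} → x ∈ Small Λ → d ∣ x
    greatest : ∀ {e} → (∀ {x} → x ∈ Small Λ → e ∣ x) → e ∣ d

module _ {Λ : NumericalSemigroup} {F : ℕ} (isF : IsFrobenius Λ F) where
  open IsFrobenius isF

  gap≤F : ∀ {x} → x ∉ Member Λ → x ≤ F
  gap≤F x∉ = ≮⇒≥ (x∉ ∘ above∈)

  small? : Decidable (Small Λ)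
  small? x = map′ (λ (x∈ , x<F) → x∈ , F , x<F , F∉)
                  (λ (x∈ , y , x<y , y∉) → x∈ , <-≤-trans x<y (gap≤F y∉))
                  (member? Λ x ×-dec x <? F)

  small-gcd : ∃ λ d → IsSmallGcd Λ d × ∃ λ v → v ∈ ⟨ Small Λ ⟩ × d + v ∈ ⟨ Small Λ ⟩
  small-gcd with bézout small? F
  ... | d , divides , v , v∈ , d+v∈ = d ,
    record { divides  = λ (x∈ , y , x<y , y∉) → divides (<-≤-trans x<y (gap≤F y∉)) (x∈ , y , x<y , y∉)
           ; greatest = λ {e} e∣ → ∣m+n∣m⇒∣n (subst (e ∣_) (+-comm d v) (∣-⟨⟩ e∣ d+v∈)) (∣-⟨⟩ e∣ v∈) } ,
    v , v∈ , d+v∈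

  -- The members of the chain decrease to the multiples of d in Λ.
  ≢1⇒inInfiniteChain : ∀ {d} → (∀ {x} → x ∈ Small Λ → d ∣ x) → d ≢ 1 → InInfiniteChain Λ
  ≢1⇒inInfiniteChain {d} d∣ d≢1 = ChainTo.inInfiniteChain
    (λ x → d ∣? x ×-dec member? Λ x) (_ ∣0 , 0∈ Λ)
    (λ (d∣x , x∈) (d∣y , y∈) → ∣m∣n⇒∣m+n d∣x d∣y , +-closed Λ x∈ y∈)
    unbounded Λ (F∉ ∘ proj₂)
    (λ x≤F x∈ → d∣ (x∈ , F , ≤∧≢⇒< x≤F (λ { refl → F∉ x∈ }) , F∉) , x∈)
    proj₂ above∈
    where
    unbounded : ∀ n → ∃ λ k → n ≤ k × k ∉ (λ x → d ∣ x × x ∈ Member Λ)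
    unbounded n with d ∣? n
    ... | no d∤n  = n , ≤-refl , d∤n ∘ proj₁
    ... | yes d∣n = suc n , n≤1+n n , d≢1 ∘ ∣-consecutive d∣n ∘ proj₁

module Chain {Λ : NumericalSemigroup} (inChain : InInfiniteChain Λ) where
  chain : ℕ → NumericalSemigroup
  chain = proj₁ inChain

  i : ℕ
  i = proj₁ (proj₂ (proj₂ inChain))

  chain-i : Member (chain i) ≐ Member Λ
  chain-i = proj₂ (proj₂ (proj₂ inChain))

  parent : ∀ j → chain j IsParentOf chain (suc j)
  parent = proj₂ (proj₁ (proj₂ inChain))

  removed : ℕ → ℕ
  removed j = proj₁ (parent j)

  -- The removed generator is at least the conductor, and the conductor lies above every gap.
  gap<removed : ∀ j {y} → y ∉ Member (chain j) → y < removed j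
  gap<removed j y∉ with parent j
  ... | _ , (_ , c , (all , _) , c≤a) , _ = <-≤-trans (≰⇒> (y∉ ∘ all)) c≤a

  removed∉ : ∀ j → removed j ∉ Member (chain (suc j))
  removed∉ j a∈ = proj₂ (proj₁ (proj₂ (proj₂ (parent j))) a∈) refl

  shrinking : ∀ j → Member (chain (suc j)) ⊆ Member (chain j)
  shrinking j = proj₁ ∘ proj₁ (proj₂ (proj₂ (parent j)))

  -- A small element lies below a gap, and every element removed later lies above that gap.
  small-persists : ∀ k → Small Λ ⊆ Small (chain (k + i))
  small-persists zero    (x∈ , y , x<y , y∉) = proj₂ chain-i x∈ , y , x<y , y∉ ∘ proj₁ chain-i
  small-persists (suc k) s with small-persists k s
  ... | x∈ , y , x<y , y∉ =
    proj₂ (proj₂ (proj₂ (parent (k + i))))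
      (x∈ , λ { refl → <⇒≱ (gap<removed (k + i) y∉) (<⇒≤ x<y) }) ,
    y , x<y , y∉ ∘ shrinking (k + i)

  ≤removed : ∀ k → k ≤ removed (k + i)
  ≤removed zero    = z≤n
  ≤removed (suc k) = ≤-<-trans (≤removed k) (gap<removed (suc k + i) (removed∉ (k + i)))

  -- Otherwise all members of the chain from `Λ` on contain every number from `v * v` on, whereas a
  -- number of at least that size is removed at step `v * v + i`.
  not-consecutive : ∀ {v} → v ∈ ⟨ Small Λ ⟩ → ¬ suc v ∈ ⟨ Small Λ ⟩
  not-consecutive {v} v∈ 1+v∈ = removed∉ (v * v + i)
    (⟨⟩⊆ (chain (suc (v * v) + i)) (proj₁ ∘ small-persists (suc (v * v)))
      (consecutive⇒cofinite v∈ 1+v∈ (≤removed (v * v))))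

chain-criterion : ∀ {Λ F} → IsFrobenius Λ F →
  ∃ λ d → IsSmallGcd Λ d × (d ≢ 1 → InInfiniteChain Λ) × (InInfiniteChain Λ → d ≢ 1)
chain-criterion {Λ} isF with small-gcd isF
... | d , isGcd , v , v∈ , d+v∈ = d , isGcd ,
  ≢1⇒inInfiniteChain isF (IsSmallGcd.divides isGcd) ,
  λ { c refl → Chain.not-consecutive {Λ} c v∈ d+v∈ }

abstract
  inInfiniteChain? : ∀ Λ → 0 < genus Λ → Dec (InInfiniteChain Λ)
  inInfiniteChain? Λ 0<g with chain-criterion (proj₂ (frobenius Λ 0<g))
  ... | d , _ , ≢1⇒chain , chain⇒≢1 with d ≟ 1
  ...   | yes d≡1 = no λ c → chain⇒≢1 c d≡1
  ...   | no d≢1  = yes (≢1⇒chain d≢1)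

-- The injection

-- With `f` the largest gap this is the parent of `Λ`.
Filled : NumericalSemigroup → ℕ → Pred ℕ 0ℓ
Filled Λ f x = x ∈ Member Λ ⊎ x ≡ f

Exchanged : NumericalSemigroup → ℕ → ℕ → Pred ℕ 0ℓ
Exchanged Λ f a x = Filled Λ f x × x ≢ a

-- Sending `f` to `a` turns the gaps of `Λ` into those of the exchanged set, so the genus is kept.
exchange : ∀ Λ {f a} → f ∉ Member Λ → a ∈ Member Λ → a ≢ 0 →
           (∀ {x y} → x ∈ Exchanged Λ f a → y ∈ Exchanged Λ f a → x + y ∈ Exchanged Λ f a) →
           ∃ λ Λ′ → genus Λ′ ≡ genus Λ × Member Λ′ ≐ Exchanged Λ f a
exchange Λ {f} {a} f∉ a∈ a≢0 closed = Λ′ , refl , (id , id)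
  where
  swap : ℕ → ℕ
  swap x with x ≟ f
  ... | yes _ = a
  ... | no _  = x
  swap∉ : ∀ {x} → x ∉ Member Λ → swap x ∉ Exchanged Λ f a
  swap∉ {x} x∉ with x ≟ f
  ... | yes _  = λ (_ , a≢a) → a≢a refl
  ... | no x≢f = λ { (inj₁ x∈ , _) → x∉ x∈ ; (inj₂ x≡f , _) → x≢f x≡f }
  swap-inj : ∀ {x y} → x ∉ Member Λ → y ∉ Member Λ → swap x ≡ swap y → x ≡ y
  swap-inj {x} {y} x∉ y∉ eq with x ≟ f | y ≟ f
  ... | yes refl | yes refl = refl
  ... | yes _    | no _     = contradiction (subst (Member Λ) eq a∈) y∉
  ... | no _     | yes _    = contradiction (subst (Member Λ) (sym eq) a∈) x∉
  ... | no _     | no _     = eq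
  swap-surj : ∀ {y} → y ∉ Exchanged Λ f a → ∃ λ x → x ∉ Member Λ × swap x ≡ y
  swap-surj {y} y∉ with y ≟ a
  ... | yes refl = f , f∉ , swap-f
    where
    swap-f : swap f ≡ a
    swap-f with f ≟ f
    ... | yes _  = refl
    ... | no f≢f = contradiction refl f≢f
  ... | no y≢a   = y , (λ y∈ → y∉ (inj₁ y∈ , y≢a)) , swap-y
    where
    swap-y : swap y ≡ y
    swap-y with y ≟ f
    ... | yes y≡f = contradiction (inj₂ y≡f , y≢a) y∉
    ... | no _    = refl
  Λ′ : NumericalSemigroup
  Λ′ = record
    { Member            = Exchanged Λ f a
    ; member?           = λ x → (member? Λ x ⊎-dec x ≟ f) ×-dec ¬? (x ≟ a)
    ; 0∈                = inj₁ (0∈ Λ) , a≢0 ∘ sym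
    ; +-closed          = closed
    ; finite-complement = genus Λ , enumeration (Subsetoid (setoid ℕ) (∁ (Exchanged Λ f a)))
        (λ i → swap (gap Λ i) , swap∉ (gap∉ Λ i))
        (λ i j eq → gap-injective Λ (swap-inj (gap∉ Λ i) (gap∉ Λ j) eq))
        λ (y , y∉) → let x , x∉ , eq = swap-surj y∉
                         i , gap≡ = gap-surjective Λ x∉
                     in i , trans (cong swap gap≡) eq
    }

multiple∈ : ∀ Λ {x y} → x ∈ Member Λ → x ∣ y → y ∈ Member Λ
multiple∈ Λ x∈ (divides-refl q) = ⟨⟩⊆ Λ id (⟨⟩-multiple q (gen x∈))

-- For positive genus this excludes `Λ` from infinite chains, by `chain-criterion`.
CoprimeSmalls : NumericalSemigroup → Set
CoprimeSmalls Λ = ∀ {e} → (∀ {x} → x ∈ Small Λ → e ∣ x) → e ≡ 1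

consecutive-small : ∀ {Λ x y} → x ∈ Member Λ → suc x ∈ Member Λ → suc x < y → y ∉ Member Λ →
                    CoprimeSmalls Λ
consecutive-small x∈ 1+x∈ 1+x<y y∉ e∣ =
  ∣-consecutive (e∣ (x∈ , _ , <-trans (n<1+n _) 1+x<y , y∉)) (e∣ (1+x∈ , _ , 1+x<y , y∉))

-- The largest gap F is 5 + k, so that 4 + k stands for F ∸ 1, and m is the
-- multiplicity of the parent, which is Λ with F added.
record InChainData (Λ : NumericalSemigroup) : Set where
  field
    k d m   : ℕ
    isF     : IsFrobenius Λ (5 + k)
    isGcd   : IsSmallGcd Λ d
    d≢1     : d ≢ 1
    0<m     : 0 < m
    m∈      : m ∈ Filled Λ (5 + k)
    m-least : ∀ {x} → 0 < x → x ∈ Filled Λ (5 + k) → m ≤ x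

  open IsFrobenius isF public
  open IsSmallGcd isGcd public

  F : ℕ
  F = 5 + k

  d∣ : ∀ {x} → x ∈ Member Λ → x < F → d ∣ x
  d∣ x∈ x<F = divides (x∈ , F , x<F , F∉)

  not-consecutive : ∀ {x} → x ∈ Member Λ → suc x ∈ Member Λ → ¬ suc x < F
  not-consecutive x∈ 1+x∈ 1+x<F = d≢1 (∣-consecutive (d∣ x∈ (<-trans (n<1+n _) 1+x<F)) (d∣ 1+x∈ 1+x<F))

  filled-<F : ∀ {x} → x ∈ Filled Λ F → x < F → x ∈ Member Λ
  filled-<F (inj₁ x∈)   _   = x∈
  filled-<F (inj₂ refl) x<x = contradiction x<x (<-irrefl refl)

  m≤F : m ≤ F
  m≤F = m-least z<s (inj₂ refl)

  m≢F⇒m∈ : m ≢ F → m ∈ Member Λ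
  m≢F⇒m∈ m≢F = filled-<F m∈ (≤∧≢⇒< m≤F m≢F)

  -- Below F + m, a sum of two nonzero elements of the parent involves only
  -- elements below F, so it is a multiple of d.
  irreducible : ∀ {a x y} → a < F + m → ¬ d ∣ a → x ∈ Filled Λ F → y ∈ Filled Λ F →
                x ≢ 0 → y ≢ 0 → x + y ≢ a
  irreducible {_} {x} {y} a<F+m d∤a x∈ y∈ x≢0 y≢0 refl =
    d∤a (∣m∣n⇒∣m+n (d∣ (filled-<F x∈ x<F) x<F) (d∣ (filled-<F y∈ y<F) y<F))
    where
    x<F : x < F
    x<F = +-cancelʳ-< m x F (≤-<-trans (+-monoʳ-≤ x (m-least (n≢0⇒n>0 y≢0) y∈)) a<F+m)
    y<F : y < F
    y<F = +-cancelʳ-< m y F (≤-<-trans (+-monoʳ-≤ y (m-least (n≢0⇒n>0 x≢0) x∈))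
            (subst (_< F + m) (+-comm x y) a<F+m))

  sibling : ∀ {a} → F < a → a < F + m → ¬ d ∣ a →
            ∃ λ Λ′ → genus Λ′ ≡ genus Λ × Member Λ′ ≐ Exchanged Λ F a
  sibling {a} F<a a<F+m d∤a = exchange Λ F∉ (above∈ F<a) (m<n⇒n≢0 F<a) closed
    where
    filled-+ : ∀ {x y} → x ≢ 0 → y ≢ 0 → x ∈ Filled Λ F → y ∈ Filled Λ F → x + y ∈ Filled Λ F
    filled-+ x≢0 y≢0 (inj₁ x∈) (inj₁ y∈) = inj₁ (+-closed Λ x∈ y∈)
    filled-+ x≢0 y≢0 (inj₂ refl) _ = inj₁ (above∈ (m<m+n F (n≢0⇒n>0 y≢0)))
    filled-+ x≢0 y≢0 _ (inj₂ refl) = inj₁ (above∈ (m<n+m F (n≢0⇒n>0 x≢0)))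
    closed : ∀ {x y} → x ∈ Exchanged Λ F a → y ∈ Exchanged Λ F a → x + y ∈ Exchanged Λ F a
    closed {x} {y} x∈ y∈ with x ≟ 0 | y ≟ 0
    ... | yes refl | _ = y∈
    ... | no _ | yes refl = subst (Exchanged Λ F a) (sym (+-identityʳ x)) x∈
    ... | no x≢0 | no y≢0 = filled-+ x≢0 y≢0 (proj₁ x∈) (proj₁ y∈) ,
                            irreducible a<F+m d∤a (proj₁ x∈) (proj₁ y∈) x≢0 y≢0

  -- The element exchanged for F: the last or the last but one element below
  -- F + m when the parent has conductor F, the second or the third after F ∸ 1
  -- when the parent has conductor F ∸ 1.
  data Choice : ℕ → Set where
    last        : 4 + k ∉ Member Λ → ¬ d ∣ 4 + k + m → Choice (4 + k + m)
    last-but-1  : 4 + k ∉ Member Λ → ∀ {a} → suc a ≡ 4 + k + m → d ∣ suc a → Choice a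
    second      : 4 + k ∈ Member Λ → d ≢ 2 → Choice (6 + k)
    third       : 4 + k ∈ Member Λ → d ≡ 2 → (m ≡ 4 → k ∈ Member Λ) → Choice (7 + k)

open InChainData using (Choice; last; last-but-1; second; third)

abstract
  inChainData : ∀ {Λ} → 5 ≤ genus Λ → InInfiniteChain Λ → InChainData Λ
  inChainData {Λ} 5≤g inChain with frobenius Λ (≤-trans (s≤s z≤n) 5≤g)
  -- All gaps lie in [1, F], so `F` is at least the genus and has the form `5 + k`.
  ... | F , isF with ≤-trans 5≤g (genus≤ Λ (IsFrobenius.above∈ isF))
  ...   | s≤s (s≤s (s≤s (s≤s (s≤s (z≤n {k}))))) with chain-criterion {Λ} isF
          | least {P = λ x → 0 < x × x ∈ Filled Λ F}
                  (λ x → 0 <? x ×-dec (member? Λ x ⊎-dec x ≟ F)) (z<s , inj₂ refl)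
  ...     | d , isGcd , _ , chain⇒≢1 | m , (0<m , m∈) , below = record
    { k = k ; d = d ; m = m ; isF = isF ; isGcd = isGcd ; d≢1 = chain⇒≢1 inChain
    ; 0<m = 0<m ; m∈ = m∈ ; m-least = λ 0<x x∈ → ≮⇒≥ λ x<m → below x<m (0<x , x∈) }

ordinary : ℕ → NumericalSemigroup
ordinary g = mkSemigroup {λ x → x ≡ 0 ⊎ g < x} (λ x → x ≟ 0 ⊎-dec g <? x) (inj₁ refl) closed (suc g) inj₂
  where
  closed : ∀ {x y} → x ≡ 0 ⊎ g < x → y ≡ 0 ⊎ g < y → x + y ≡ 0 ⊎ g < x + y
  closed (inj₁ refl) y∈ = y∈
  closed {x} {y} (inj₂ g<x) _ = inj₂ (<-≤-trans g<x (m≤m+n x y))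

ordinary-genus : ∀ g → genus (ordinary g) ≡ g
ordinary-genus g = ≤-antisym (genus≤ (ordinary g) inj₂)
  (gaps≤genus (ordinary g) (suc ∘ toℕ) (toℕ-injective ∘ suc-injective)
    λ i → λ { (inj₂ g<i) → <⇒≱ g<i (toℕ<n i) })

-- In this form `sibling` and `compare-siblings` apply to the hyperelliptic images. Here `d` is 0,
-- since 0 is the only small element.
ordinary-data : ∀ k → InChainData (ordinary (5 + k))
ordinary-data k = record
  { k = k ; d = 0 ; m = 5 + k
  ; isF = record { F∉ = λ { (inj₂ F<F) → <-irrefl refl F<F } ; above∈ = inj₂ }
  ; isGcd = record
      { divides  = λ { (inj₁ refl , _) → 0 ∣0
                     ; (inj₂ F<x , y , x<y , y∉) → contradiction (inj₂ (<-trans F<x x<y)) y∉ }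
      ; greatest = λ _ → _ ∣0 }
  ; d≢1 = λ ()
  ; 0<m = z<s
  ; m∈ = inj₂ refl
  ; m-least = λ { 0<0 (inj₁ (inj₁ refl)) → contradiction 0<0 (<-irrefl refl)
                ; _ (inj₁ (inj₂ F<x)) → <⇒≤ F<x
                ; _ (inj₂ refl) → ≤-refl } }

-- For Λ = {0, 4, …, 4j, 4j + 2} ∪ [4j + 4, ∞), where F = 4j + 3, the only
-- generator left to remove already serves the other in-chain child of the
-- parent, so 4j + 2 is exchanged for 4j + 1.
IsQuarticImage : ∀ {Λ} → InChainData Λ → NumericalSemigroup → Set
IsQuarticImage {Λ} D Λ′ = Member Λ′ ≐ Exchanged Λ (3 + k) (4 + k)
  where open InChainData D using (k)

-- If 2 ∈ Λ then Λ is the only child of its parent; its image is a child of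
-- the ordinary semigroup of genus 4 + k that is the image of no other Λ.
data Image {Λ : NumericalSemigroup} (D : InChainData Λ) (Λ′ : NumericalSemigroup) : Set where
  generic       : ∀ {a} → 2 ∉ Member Λ → Choice D a →
                  Member Λ′ ≐ Exchanged Λ (InChainData.F D) a → Image D Λ′
  quartic       : 4 + InChainData.k D ∈ Member Λ → IsQuarticImage D Λ′ → Image D Λ′
  hyperelliptic : 2 ∈ Member Λ → ∀ k →
                  Member Λ′ ≐ Exchanged (ordinary (5 + k)) (5 + k) (8 + k) → Image D Λ′

-- Divisibility facts and the construction of the images

+-shift : ∀ i {j} k {m} → j ≤ m → i + (j + k) ≤ i + (k + m)
+-shift i {j} k {m} j≤m = +-monoʳ-≤ i (subst (_≤ k + m) (+-comm k j) (+-monoʳ-≤ k j≤m))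

∣2⇒≡1∨≡2 : ∀ {d} → d ∣ 2 → d ≡ 1 ⊎ d ≡ 2
∣2⇒≡1∨≡2 {0} 0∣2 = contradiction (0∣⇒≡0 0∣2) λ ()
∣2⇒≡1∨≡2 {1} _   = inj₁ refl
∣2⇒≡1∨≡2 {2} _   = inj₂ refl
∣2⇒≡1∨≡2 {suc (suc (suc d))} d∣2 = contradiction (∣⇒≤ d∣2) λ { (s≤s (s≤s ())) }

∣3⇒≡1∨≡3 : ∀ {d} → d ∣ 3 → d ≡ 1 ⊎ d ≡ 3
∣3⇒≡1∨≡3 {0} 0∣3 = contradiction (0∣⇒≡0 0∣3) λ ()
∣3⇒≡1∨≡3 {1} _   = inj₁ refl
∣3⇒≡1∨≡3 {2} 2∣3 = contradiction (∣-consecutive (∣-refl {2}) 2∣3) λ ()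
∣3⇒≡1∨≡3 {3} _   = inj₂ refl
∣3⇒≡1∨≡3 {suc (suc (suc (suc d)))} d∣3 = contradiction (∣⇒≤ d∣3) λ { (s≤s (s≤s (s≤s ()))) }

even⇒4∣∨4∣+2 : ∀ {x} → 2 ∣ x → 4 ∣ x ⊎ 4 ∣ 2 + x
even⇒4∣∨4∣+2 (divides-refl q) = go q
  where
  go : ∀ q → 4 ∣ q * 2 ⊎ 4 ∣ 2 + q * 2
  go zero = inj₁ (4 ∣0)
  go (suc q) with go q
  ... | inj₁ 4∣  = inj₂ (∣m∣n⇒∣m+n (∣-refl {4}) 4∣)
  ... | inj₂ 4∣  = inj₁ 4∣

module _ {Λ : NumericalSemigroup} (D : InChainData Λ) where
  open InChainData D hiding (Choice; last; last-but-1; second; third)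

  2∉⇒3≤m : 2 ∉ Member Λ → 3 ≤ m
  2∉⇒3≤m 2∉ = ≤∧≢⇒< (≤∧≢⇒< 0<m 1≢m) 2≢m
    where
    1≢m : 1 ≢ m
    1≢m 1≡m = F∉ (multiple∈ Λ (m≢F⇒m∈ λ m≡F → contradiction (trans 1≡m m≡F) λ ())
                   (subst (_∣ F) 1≡m (1∣ F)))
    2≢m : 2 ≢ m
    2≢m 2≡m = 2∉ (subst (Member Λ) (sym 2≡m)
                   (m≢F⇒m∈ λ m≡F → contradiction (trans 2≡m m≡F) λ ()))

  -- These are the hypotheses of `sibling`. When `4 + k` is in `Λ`, it is divisible by `d`, so `d`
  -- would divide 2 or 3 if it divided the chosen element.
  choice-bounds : 3 ≤ m → ∀ {a} → Choice D a → F < a × a < F + m × ¬ d ∣ a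
  choice-bounds 3≤m (last E∉ d∤a) = ≤-trans (n≤1+n _) (+-shift 4 k 3≤m) , n<1+n _ , d∤a
  choice-bounds 3≤m (last-but-1 E∉ refl d∣1+a) =
    +-shift 3 k 3≤m , <-trans (n<1+n _) (n<1+n _) , λ d∣a → d≢1 (∣-consecutive d∣a d∣1+a)
  choice-bounds 3≤m (second E∈ d≢2) =
    n<1+n _ , <-≤-trans (n<1+n _) (≤-trans (n≤1+n _) (+-shift 5 k 3≤m)) , d∤6+k
    where
    d∤6+k : ¬ d ∣ 6 + k
    d∤6+k d∣6+k with ∣2⇒≡1∨≡2 (∣m+n∣m⇒∣n (subst (d ∣_) (+-comm 2 (4 + k)) d∣6+k) (d∣ E∈ (n<1+n _)))
    ... | inj₁ d≡1 = d≢1 d≡1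
    ... | inj₂ d≡2 = d≢2 d≡2
  choice-bounds 3≤m (third E∈ d≡2 _) =
    <-trans (n<1+n _) (n<1+n _) , +-shift 5 k 3≤m , d∤7+k
    where
    d∤7+k : ¬ d ∣ 7 + k
    d∤7+k d∣7+k with ∣3⇒≡1∨≡3 (∣m+n∣m⇒∣n (subst (d ∣_) (+-comm 3 (4 + k)) d∣7+k) (d∣ E∈ (n<1+n _)))
    ... | inj₁ d≡1 = d≢1 d≡1
    ... | inj₂ d≡3 = contradiction (trans (sym d≡2) d≡3) λ ()

  -- With `m` = 3 the choice `last-but-1` would be F + 1, too close to `F` to leave two consecutive
  -- elements. This does not occur: `d` would be 3, making `4 + k` a multiple of 3, which is then in
  -- `Λ`.
  m≢3 : 4 + k ∉ Member Λ → d ∣ 4 + k + m → m ≢ 3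
  m≢3 E∉ d∣′ m≡3 = E∉ (multiple∈ Λ 3∈ (subst (_∣ 4 + k) d≡3 d∣E))
    where
    3∈ : 3 ∈ Member Λ
    3∈ = subst (Member Λ) m≡3 (m≢F⇒m∈ λ m≡F → contradiction (trans (sym m≡3) m≡F) λ ())
    d∣3 : d ∣ 3
    d∣3 = d∣ 3∈ (s≤s (s≤s (s≤s (s≤s z≤n))))
    d≡3 : d ≡ 3
    d≡3 with ∣3⇒≡1∨≡3 d∣3
    ... | inj₁ d≡1 = contradiction d≡1 d≢1
    ... | inj₂ d≡3 = d≡3
    d∣E : d ∣ 4 + k
    d∣E = ∣m+n∣m⇒∣n (subst (d ∣_) (trans (cong (4 + k +_) m≡3) (+-comm (4 + k) 3)) d∣′) d∣3

  -- The consecutive elements are F and F + 1 when the parent has conductor F, and F - 1 and F when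
  -- it has conductor F - 1.
  sibling-coprime : 3 ≤ m → ∀ {a} → Choice D a → ∀ {Λ′} → Member Λ′ ≐ Exchanged Λ F a → CoprimeSmalls Λ′
  sibling-coprime 3≤m {a} choice {Λ′} (⊆₁ , ⊆₂) with choice-bounds 3≤m choice
  ... | F<a , _ , _ = cases choice
    where
    a∉ : a ∉ Member Λ′
    a∉ a∈ = proj₂ (⊆₁ a∈) refl
    F∈ : F ∈ Member Λ′
    F∈ = ⊆₂ (inj₂ refl , <⇒≢ F<a)
    from-F : suc F < a → CoprimeSmalls Λ′
    from-F 1+F<a = consecutive-small {Λ′} F∈ (⊆₂ (inj₁ (above∈ (n<1+n _)) , <⇒≢ 1+F<a)) 1+F<a a∉
    from-E : 4 + k ∈ Member Λ → CoprimeSmalls Λ′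
    from-E E∈ = consecutive-small {Λ′} (⊆₂ (inj₁ E∈ , <⇒≢ (<-trans (n<1+n _) F<a))) F∈ F<a a∉
    cases : Choice D a → CoprimeSmalls Λ′
    cases (last _ _)               = from-F (+-shift 4 k 3≤m)
    cases (last-but-1 E∉ refl d∣1+a) = from-F (+-shift 3 k (≤∧≢⇒< 3≤m (m≢3 E∉ d∣1+a ∘ sym)))
    cases (second E∈ _)            = from-E E∈
    cases (third E∈ _ _)           = from-E E∈

  -- The case without a `Choice`; `4 + k` is the 4j + 2 in the description of `IsQuarticImage`.
  module Quartic (m≡4 : m ≡ 4) (E∈ : 4 + k ∈ Member Λ) (k∉ : k ∉ Member Λ) (d≡2 : d ≡ 2) where

    4∈ : 4 ∈ Member Λ
    4∈ = subst (Member Λ) m≡4 (m≢F⇒m∈ λ m≡F → contradiction (trans (sym m≡4) m≡F) λ ())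

    4∤k : ¬ 4 ∣ k
    4∤k 4∣k = k∉ (multiple∈ Λ 4∈ 4∣k)

    even : ∀ {x} → x ∈ Member Λ → x < F → 2 ∣ x
    even x∈ x<F = subst (_∣ _) d≡2 (d∣ x∈ x<F)

    4∣2+k : 4 ∣ 2 + k
    4∣2+k with even⇒4∣∨4∣+2 (∣m+n∣m⇒∣n (even E∈ (n<1+n _)) (n∣m*n 2 {2}))
    ... | inj₁ 4∣k   = contradiction 4∣k 4∤k
    ... | inj₂ 4∣2+k = 4∣2+k

    -- An `x` that is 2 modulo 4 is congruent to `k`. Above `k` it would be at least `4 + k`;
    -- otherwise adding a multiple of 4 to it would put `k` in `Λ`.
    4∣ : ∀ {x} → x ∈ Member Λ → x < 4 + k → 4 ∣ x
    4∣ {x} x∈ x<E with even⇒4∣∨4∣+2 (even x∈ (<-trans x<E (n<1+n _)))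
    ... | inj₁ 4∣x = 4∣x
    ... | inj₂ 4∣2+x with k <? x
    ...   | yes k<x = contradiction (∣⇒≤ {{>-nonZero (m<n⇒0<n∸m k<x)}} 4∣x∸k)
              (<⇒≱ (subst (x ∸ k <_) (m+n∸n≡m 4 k) (∸-monoˡ-< x<E (<⇒≤ k<x))))
      where
      4∣x∸k : 4 ∣ x ∸ k
      4∣x∸k = ∣m+n∣m⇒∣n {m = 2 + k} (subst (4 ∣_) (sym (cong (2 +_) (m+[n∸m]≡n (<⇒≤ k<x)))) 4∣2+x) 4∣2+k
    ...   | no k≮x = contradiction (subst (Member Λ) x+[k∸x]≡k (+-closed Λ x∈ (multiple∈ Λ 4∈ 4∣k∸x))) k∉
      where
      x+[k∸x]≡k : x + (k ∸ x) ≡ k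
      x+[k∸x]≡k = m+[n∸m]≡n (≮⇒≥ k≮x)
      4∣k∸x : 4 ∣ k ∸ x
      4∣k∸x = ∣m+n∣m⇒∣n {m = 2 + x} (subst (4 ∣_) (sym (cong (2 +_) x+[k∸x]≡k)) 4∣2+k) 4∣2+x

    3+k∉ : 3 + k ∉ Member Λ
    3+k∉ 3+k∈ = not-consecutive 3+k∈ E∈ (n<1+n _)

    0<k : 0 < k
    0<k = positive-nonmember Λ k∉

    4≤ : ∀ {x} → x ∈ Exchanged Λ (3 + k) (4 + k) → x ≢ 0 → 4 ≤ x
    4≤ (inj₁ x∈ , _)   x≢0 = subst (_≤ _) m≡4 (m-least (n≢0⇒n>0 x≢0) (inj₁ x∈))
    4≤ (inj₂ refl , _) _   = s≤s (s≤s (s≤s 0<k))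

    far : ∀ {y} → 4 ≤ y → F < 3 + k + y
    far 4≤y = ≤-trans (n≤1+n _) (+-shift 3 k 4≤y)

    far∈ : ∀ {x} → F < x → x ∈ Exchanged Λ (3 + k) (4 + k)
    far∈ F<x = inj₁ (above∈ F<x) , λ { refl → <⇒≱ F<x (n≤1+n _) }

    -- The sum of `3 + k` and a nonzero element exceeds `F`. Two other elements could only fail by
    -- adding up to `4 + k`, but below `4 + k` they are multiples of 4, and 4 does not divide `k`.
    closed : ∀ {x y} → x ∈ Exchanged Λ (3 + k) (4 + k) → y ∈ Exchanged Λ (3 + k) (4 + k) →
             x + y ∈ Exchanged Λ (3 + k) (4 + k)
    closed {x} {y} x∈ y∈ with x ≟ 0 | y ≟ 0
    ... | yes refl | _ = y∈
    ... | no _ | yes refl = subst (Exchanged Λ (3 + k) (4 + k)) (sym (+-identityʳ x)) x∈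
    closed {x} {y} x∈@(inj₂ refl , _) y∈ | no _ | no y≢0 = far∈ (far (4≤ y∈ y≢0))
    closed {x} {y} x∈ y∈@(inj₂ refl , _) | no x≢0 | no _ =
      far∈ (subst (F <_) (+-comm (3 + k) x) (far (4≤ x∈ x≢0)))
    closed {x} {y} (inj₁ x∈ , x≢E) (inj₁ y∈ , y≢E) | no _ | no _ = inj₁ (+-closed Λ x∈ y∈) , λ x+y≡E →
      4∤k (∣m+n∣m⇒∣n {m = 4} (subst (4 ∣_) x+y≡E (∣m∣n⇒∣m+n
        (4∣ x∈ (≤∧≢⇒< (subst (x ≤_) x+y≡E (m≤m+n x y)) x≢E))
        (4∣ y∈ (≤∧≢⇒< (subst (y ≤_) x+y≡E (m≤n+m y x)) y≢E)))) ∣-refl)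

    image : ∃ λ Λ′ → genus Λ′ ≡ genus Λ × Member Λ′ ≐ Exchanged Λ (3 + k) (4 + k)
    image = exchange Λ 3+k∉ E∈ (λ ()) closed

    -- 4 and `3 + k` lie below the gap `F`; since 4 divides `2 + k`, a common divisor divides two
    -- consecutive numbers.
    coprime : ∀ {Λ′} → Member Λ′ ≐ Exchanged Λ (3 + k) (4 + k) → CoprimeSmalls Λ′
    coprime {Λ′} (⊆₁ , ⊆₂) {e} e∣ = ∣-consecutive (∣-trans e∣4 4∣2+k) e∣3+k
      where
      F∉′ : F ∉ Member Λ′
      F∉′ F∈ with ⊆₁ F∈
      ... | inj₁ F∈Λ , _ = F∉ F∈Λ
      ... | inj₂ () , _
      e∣4 : e ∣ 4
      e∣4 = e∣ (⊆₂ (inj₁ 4∈ , <⇒≢ (m<m+n 4 0<k)) , F , s≤s (s≤s (s≤s (s≤s z<s))) , F∉′)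
      e∣3+k : e ∣ 3 + k
      e∣3+k = e∣ (⊆₂ (inj₂ refl , λ ()) , F , s≤s (n≤1+n _) , F∉′)

  choose : 2 ∉ Member Λ →
           ∃ (Choice D) ⊎ (m ≡ 4 × 4 + k ∈ Member Λ × k ∉ Member Λ × d ≡ 2)
  choose 2∉ with member? Λ (4 + k)
  ... | no E∉ with d ∣? 4 + k + m
  ...   | yes d∣′ = inj₁ (_ , last-but-1 E∉ refl d∣′)
  ...   | no d∤   = inj₁ (_ , last E∉ d∤)
  choose 2∉ | yes E∈ with d ≟ 2
  ...   | no d≢2 = inj₁ (_ , second E∈ d≢2)
  ...   | yes d≡2 with m ≟ 4 | member? Λ k
  ...     | yes m≡4 | no k∉ = inj₂ (m≡4 , E∈ , k∉ , d≡2)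
  ...     | yes _   | yes k∈ = inj₁ (_ , third E∈ d≡2 λ _ → k∈)
  ...     | no m≢4  | _      = inj₁ (_ , third E∈ d≡2 λ m≡4 → contradiction m≡4 m≢4)

  abstract
    image : 5 ≤ genus Λ → ∃ λ Λ′ → genus Λ′ ≡ genus Λ × CoprimeSmalls Λ′ × Image D Λ′
    image 5≤g with member? Λ 2
    ... | no 2∉ with choose 2∉
    ...   | inj₁ (a , choice) =
      let 3≤m = 2∉⇒3≤m 2∉
          F<a , a<F+m , d∤a = choice-bounds 3≤m choice
          Λ′ , genus≡ , mem = sibling F<a a<F+m d∤a
      in Λ′ , genus≡ , sibling-coprime 3≤m choice {Λ′} mem , generic 2∉ choice mem
    ...   | inj₂ (m≡4 , E∈ , k∉ , d≡2) =
      let module Q = Quartic m≡4 E∈ k∉ d≡2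
          Λ′ , genus≡ , mem = Q.image
      in Λ′ , genus≡ , Q.coprime {Λ′} mem , quartic E∈ mem
    image 5≤g | yes 2∈ with m≤n⇒∃[o]m+o≡n 5≤g
    -- For the two in-chain children of the parent of this ordinary semigroup, the chosen elements
    -- are 9 + 2k₀ and 7 + k₀, so 8 + k₀ is free.
    ... | k₀ , genus≡ with InChainData.sibling (ordinary-data k₀) {8 + k₀}
                            (m<n+m (5 + k₀) (z<s {2})) (+-shift 5 k₀ (s≤s (s≤s (s≤s (s≤s z≤n)))))
                            (λ 0∣ → contradiction (0∣⇒≡0 0∣) λ ())
    ...   | Λ′ , genus≡′ , mem =
      Λ′ , trans genus≡′ (trans (ordinary-genus (5 + k₀)) genus≡) ,
      consecutive-small {Λ′} (proj₂ mem (inj₂ refl , λ ())) (proj₂ mem (inj₁ (inj₂ (n<1+n _)) , λ ()))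
        (n≤1+n (7 + k₀)) (λ a∈ → proj₂ (proj₁ mem a∈) refl) ,
      hyperelliptic 2∈ k₀ mem

-- Injectivity of the image map

private variable
  Λ Λ₁ Λ₂ Λ₁′ Λ₂′ : NumericalSemigroup

record IsSibling (D : InChainData Λ) (a : ℕ) (Λ′ : NumericalSemigroup) : Set where
  constructor isSibling
  open InChainData D using (F)
  field
    F<a    : F < a
    member : Member Λ′ ≐ Exchanged Λ F a

  a∉ : a ∉ Member Λ′
  a∉ a∈ = proj₂ (proj₁ member a∈) refl

  F<x⇒∈ : ∀ {x} → F < x → x ≢ a → x ∈ Member Λ′
  F<x⇒∈ F<x x≢a = proj₂ member (inj₁ (InChainData.above∈ D F<x) , x≢a)

sibling-removed-≤ : ∀ {D₁ : InChainData Λ₁} {D₂ : InChainData Λ₂} {a₁ a₂} →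
  IsSibling D₁ a₁ Λ₁′ → IsSibling D₂ a₂ Λ₂′ → Member Λ₁′ ⊆ Member Λ₂′ → a₂ ≤ a₁
sibling-removed-≤ S₁ S₂ ⊆ = ≮⇒≥ λ a₁<a₂ →
  IsSibling.a∉ S₂ (⊆ (IsSibling.F<x⇒∈ S₁ (<-trans (IsSibling.F<a S₁) a₁<a₂) (<⇒≢ a₁<a₂ ∘ sym)))

-- The two in-chain children of a common parent: Λ₁ lacks its conductor, Λ₂ the
-- successor of its conductor.
record InChainSiblings (D₁ : InChainData Λ₁) (D₂ : InChainData Λ₂) : Set where
  open InChainData D₁ renaming (k to k₁; d to d₁; m to m₁; F to F₁)
  open InChainData D₂ renaming (k to k₂; d to d₂; m to m₂; F to F₂)
  field
    k₂≡1+k₁ : k₂ ≡ suc k₁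
    E₁∉     : 4 + k₁ ∉ Member Λ₁
    F₁∈     : 5 + k₁ ∈ Member Λ₂
    m₁≡m₂   : m₁ ≡ m₂
    d₂∣d₁   : d₂ ∣ d₁
    d₂∣m    : d₂ ∣ m₁
    d₂∣F₁   : d₂ ∣ 5 + k₁
    ⊆-filled : Member Λ₂ ⊆ Filled Λ₁ F₁

module _ {D₁ : InChainData Λ₁} {D₂ : InChainData Λ₂} where
  open InChainData D₁ using () renaming (k to k₁; d to d₁; m to m₁; F to F₁)
  open InChainData D₂ using () renaming (k to k₂; d to d₂; m to m₂; F to F₂)
  private
    module D₁ = InChainData D₁
    module D₂ = InChainData D₂

  same-filled : Filled Λ₁ F₁ ≐ Filled Λ₂ F₂ → k₁ ≡ k₂ → Member Λ₁ ⊆ Member Λ₂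
  same-filled (⊆₁ , _) refl x∈ with ⊆₁ (inj₁ x∈)
  ... | inj₁ x∈₂  = x∈₂
  ... | inj₂ refl = contradiction x∈ D₁.F∉

  -- Below `F₂` the common parent agrees with `Λ₂`, which has no consecutive elements there. The
  -- parent contains `F₁` and everything above it, so `F₂` is the successor of `F₁`; likewise
  -- `4 + k₁` is not in `Λ₁`.
  in-chain-siblings : Filled Λ₁ F₁ ≐ Filled Λ₂ F₂ → F₁ < F₂ → InChainSiblings D₁ D₂
  in-chain-siblings (⊆₁ , ⊆₂) F₁<F₂ = record
    { k₂≡1+k₁  = +-cancelˡ-≡ 5 k₂ (suc k₁) F₂≡1+F₁
    ; E₁∉      = λ E₁∈ → D₂.not-consecutive (into E₁∈ (<-trans (n<1+n _) F₁<F₂)) F₁∈ F₁<F₂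
    ; F₁∈      = F₁∈
    ; m₁≡m₂    = m₁≡m₂
    ; d₂∣d₁    = D₁.greatest λ (x∈ , y , x<y , y∉) →
        let x<F₂ = <-trans (<-≤-trans x<y (gap≤F D₁.isF y∉)) F₁<F₂ in D₂.d∣ (into x∈ x<F₂) x<F₂
    ; d₂∣m     = D₂.d∣ (D₂.filled-<F (⊆₁ D₁.m∈) m₁<F₂) m₁<F₂
    ; d₂∣F₁    = D₂.d∣ F₁∈ F₁<F₂
    ; ⊆-filled = ⊆₂ ∘ inj₁
    }
    where
    into : ∀ {x} → x ∈ Member Λ₁ → x < F₂ → x ∈ Member Λ₂
    into x∈ = D₂.filled-<F (⊆₁ (inj₁ x∈))
    F₁∈ : F₁ ∈ Member Λ₂
    F₁∈ = D₂.filled-<F (⊆₁ (inj₂ refl)) F₁<F₂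
    F₂≡1+F₁ : F₂ ≡ suc F₁
    F₂≡1+F₁ = ≤-antisym
      (≮⇒≥ λ 1+F₁<F₂ → D₂.not-consecutive F₁∈ (into (D₁.above∈ (n<1+n _)) 1+F₁<F₂) 1+F₁<F₂) F₁<F₂
    m₁≡m₂ : m₁ ≡ m₂
    m₁≡m₂ = ≤-antisym (D₁.m-least D₂.0<m (⊆₂ D₂.m∈)) (D₂.m-least D₁.0<m (⊆₁ D₁.m∈))
    m₁<F₂ : m₁ < F₂
    m₁<F₂ = ≤-<-trans D₁.m≤F F₁<F₂

  -- `E₁∉` leaves `last` and `last-but-1` for `D₁`, and `E₂∈` leaves `second` and `third` for `D₂`;
  -- these are excluded case by case.
  distinct-choices : InChainSiblings D₁ D₂ → ∀ {a₁ a₂} → a₁ ≡ a₂ → Choice D₁ a₁ → ¬ Choice D₂ a₂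
  distinct-choices S = disjoint
    where
    open InChainSiblings S
    E₂∈ : 4 + k₂ ∈ Member Λ₂
    E₂∈ = subst (λ k → 4 + k ∈ Member Λ₂) (sym k₂≡1+k₁) F₁∈
    disjoint : ∀ {a₁ a₂} → a₁ ≡ a₂ → Choice D₁ a₁ → ¬ Choice D₂ a₂
    disjoint _ (second E₁∈ _)  _ = E₁∉ E₁∈
    disjoint _ (third E₁∈ _ _) _ = E₁∉ E₁∈
    disjoint _ _ (last E₂∉ _)           = E₂∉ E₂∈
    disjoint _ _ (last-but-1 E₂∉ _ _)   = E₂∉ E₂∈
    -- `d₂` divides both `4 + k₁ + m₁`, through `d₁`, and `5 + k₁ + m₁`.
    disjoint _ (last-but-1 _ 1+a≡ d₁∣) _ = D₂.d≢1 (∣-consecutive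
      (subst (d₂ ∣_) 1+a≡ (∣-trans d₂∣d₁ d₁∣)) (∣m∣n⇒∣m+n d₂∣F₁ d₂∣m))
    -- Equal choices force `m₁` = 3, so `d₂` = 3 divides `F₁`, which is then a multiple of `m₁`.
    disjoint eq (last _ _) (second _ _) = D₁.F∉ (multiple∈ Λ₁ (D₁.m≢F⇒m∈ m₁≢F₁) m₁∣F₁)
      where
      m₁≡3 : m₁ ≡ 3
      m₁≡3 = +-cancelˡ-≡ (4 + k₁) m₁ 3
        (trans eq (trans (cong (6 +_) k₂≡1+k₁) (cong (4 +_) (+-comm 3 k₁))))
      m₁≢F₁ : m₁ ≢ F₁
      m₁≢F₁ m₁≡F₁ = contradiction (trans (sym m₁≡3) m₁≡F₁) λ ()
      m₁∣F₁ : m₁ ∣ F₁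
      m₁∣F₁ with ∣3⇒≡1∨≡3 (subst (d₂ ∣_) m₁≡3 d₂∣m)
      ... | inj₁ d₂≡1 = contradiction d₂≡1 D₂.d≢1
      ... | inj₂ d₂≡3 = subst (_∣ F₁) (trans d₂≡3 (sym m₁≡3)) d₂∣F₁
    -- Equal choices force `m₁` = 4, and then the last condition of `third` puts `k₂`, which is
    -- `suc k₁`, in `Λ₂` and hence in `Λ₁`; but `F₁` is 4 + (1 + k₁).
    disjoint eq (last _ _) (third _ _ k₂∈) = D₁.F∉ (+-closed Λ₁ 4∈ 1+k₁∈)
      where
      m₁≡4 : m₁ ≡ 4
      m₁≡4 = +-cancelˡ-≡ (4 + k₁) m₁ 4 (trans eq (trans (cong (7 +_) k₂≡1+k₁) (cong (4 +_) (+-comm 4 k₁))))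
      4∈ : 4 ∈ Member Λ₁
      4∈ = subst (Member Λ₁) m₁≡4 (D₁.m≢F⇒m∈ λ m₁≡F₁ → contradiction (trans (sym m₁≡4) m₁≡F₁) λ ())
      1+k₁∈ : suc k₁ ∈ Member Λ₁
      1+k₁∈ = D₁.filled-<F (⊆-filled (subst (Member Λ₂) k₂≡1+k₁ (k₂∈ (trans (sym m₁≡m₂) m₁≡4))))
                (s≤s (s≤s (m≤n+m k₁ 3)))

siblings-same-filled : ∀ {D₁ : InChainData Λ₁} {D₂ : InChainData Λ₂} {a} →
  IsSibling D₁ a Λ₁′ → IsSibling D₂ a Λ₂′ → Member Λ₁′ ⊆ Member Λ₂′ →
  Filled Λ₁ (InChainData.F D₁) ⊆ Filled Λ₂ (InChainData.F D₂)
siblings-same-filled {D₂ = D₂} {a} S₁ S₂ ⊆ {x} x∈ with x ≟ a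
... | yes refl = inj₁ (InChainData.above∈ D₂ (IsSibling.F<a S₂))
... | no x≢a   = proj₁ (proj₁ (IsSibling.member S₂) (⊆ (proj₂ (IsSibling.member S₁) (x∈ , x≢a))))

Comparison : InChainData Λ₁ → InChainData Λ₂ → Set
Comparison {Λ₁} {Λ₂} D₁ D₂ =
  (Member Λ₁ ≐ Member Λ₂ × InChainData.k D₁ ≡ InChainData.k D₂) ⊎
  InChainSiblings D₁ D₂ ⊎ InChainSiblings D₂ D₁

-- Two in-chain semigroups with the same image are equal, unless they are the
-- two in-chain children of a common parent.
compare-siblings : ∀ {D₁ : InChainData Λ₁} {D₂ : InChainData Λ₂} {a₁ a₂} →
  IsSibling D₁ a₁ Λ₁′ → IsSibling D₂ a₂ Λ₂′ → Member Λ₁′ ≐ Member Λ₂′ →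
  a₁ ≡ a₂ × Comparison D₁ D₂
compare-siblings {Λ₁ = Λ₁} {Λ₂ = Λ₂} {D₁ = D₁} {D₂} S₁ S₂ (⊆₁ , ⊆₂)
  with ≤-antisym (sibling-removed-≤ S₂ S₁ ⊆₂) (sibling-removed-≤ S₁ S₂ ⊆₁)
... | refl = refl , result (<-cmp (InChainData.F D₁) (InChainData.F D₂))
  where
  filled : Filled Λ₁ (InChainData.F D₁) ≐ Filled Λ₂ (InChainData.F D₂)
  filled = siblings-same-filled S₁ S₂ ⊆₁ , siblings-same-filled S₂ S₁ ⊆₂
  filled′ : Filled Λ₂ (InChainData.F D₂) ≐ Filled Λ₁ (InChainData.F D₁)
  filled′ = siblings-same-filled S₂ S₁ ⊆₂ , siblings-same-filled S₁ S₂ ⊆₁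
  result : Tri (InChainData.F D₁ < InChainData.F D₂) (InChainData.F D₁ ≡ InChainData.F D₂)
               (InChainData.F D₂ < InChainData.F D₁) → Comparison D₁ D₂
  result (tri< F₁<F₂ _ _) = inj₂ (inj₁ (in-chain-siblings filled F₁<F₂))
  result (tri> _ _ F₂<F₁) = inj₂ (inj₂ (in-chain-siblings filled′ F₂<F₁))
  result (tri≈ _ F₁≡F₂ _) = inj₁
    ((same-filled {D₁ = D₁} {D₂} filled k≡ , same-filled {D₁ = D₂} {D₁} filled′ (sym k≡)) , k≡)
    where
    k≡ = +-cancelˡ-≡ 5 _ _ F₁≡F₂

-- Only semigroups with the same parent matter. The ordinary one has `m` = F and `d` = 0, so its
-- choice is not 8 + k₀. For its in-chain sibling `5 + k₀` divides `d`, which rules out `third`, and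
-- `second` gives 7 + k₀.
ordinary-sibling≢ : ∀ {D : InChainData Λ} {a k} → Choice D a →
  IsSibling (ordinary-data k) (8 + k) Λ₁′ → IsSibling D a Λ₂′ → ¬ Member Λ₁′ ≐ Member Λ₂′
ordinary-sibling≢ {Λ = Λ} {D = D} {a} {k₀} choice S₀ S eq with compare-siblings S₀ S eq
... | 8+k₀≡a , cases = impossible cases 8+k₀≡a choice
  where
  open InChainData D hiding (Choice; last; last-but-1; second; third)
  module Ord = InChainData (ordinary-data k₀)
  impossible : Comparison (ordinary-data k₀) D → ∀ {a} → 8 + k₀ ≡ a → ¬ Choice D a
  impossible (inj₁ ((⊆₁ , ⊆₂) , k₀≡k)) = same-semigroup
    where
    m≡F : m ≡ F
    m≡F with m∈
    ... | inj₂ m≡F = m≡F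
    ... | inj₁ m∈Λ with ⊆₂ m∈Λ
    ...   | inj₁ m≡0  = contradiction (sym m≡0) (<⇒≢ 0<m)
    ...   | inj₂ F<m  = contradiction m≤F (<⇒≱ (subst (λ k → 5 + k < m) k₀≡k F<m))
    E∉ : 4 + k ∉ Member Λ
    E∉ E∈ with ⊆₂ E∈
    ... | inj₂ F<E = <⇒≱ (subst (λ k′ → 5 + k′ < 4 + k) k₀≡k F<E) (n≤1+n _)
    0∣d : 0 ∣ d
    0∣d = greatest λ (x∈ , y , x<y , y∉) → Ord.divides (⊆₂ x∈ , y , x<y , y∉ ∘ ⊆₁)
    same-semigroup : ∀ {a} → 8 + k₀ ≡ a → ¬ Choice D a
    same-semigroup eq (last _ _) = contradiction (trans (sym m≡F) m≡4) λ ()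
      where
      m≡4 : m ≡ 4
      m≡4 = +-cancelˡ-≡ (4 + k) m 4 (trans (sym eq) (trans (cong (8 +_) k₀≡k) (cong (4 +_) (+-comm 4 k))))
    same-semigroup _ (last-but-1 _ _ d∣) = contradiction (0∣⇒≡0 (∣-trans 0∣d d∣)) λ ()
    same-semigroup _ (second E∈ _)       = E∉ E∈
    same-semigroup _ (third E∈ _ _)      = E∉ E∈
  impossible (inj₂ (inj₁ siblings)) = second-child
    where
    open InChainSiblings siblings
    F₀∣ : ∀ {x} → x ∈ Small Λ → 5 + k₀ ∣ x
    F₀∣ (x∈ , y , x<y , y∉) with ⊆-filled x∈
    ... | inj₁ (inj₁ refl) = _ ∣0
    ... | inj₂ refl        = ∣-refl
    ... | inj₁ (inj₂ F₀<x) = contradiction (<-≤-trans x<y (subst (λ k′ → y ≤ 5 + k′) k₂≡1+k₁ (gap≤F isF y∉)))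
                               (≤⇒≯ F₀<x)
    E∈ : 4 + k ∈ Member Λ
    E∈ = subst (λ k → 4 + k ∈ Member Λ) (sym k₂≡1+k₁) F₁∈
    second-child : ∀ {a} → 8 + k₀ ≡ a → ¬ Choice D a
    second-child _ (last E∉ _)         = E∉ E∈
    second-child _ (last-but-1 E∉ _ _) = E∉ E∈
    second-child eq (second _ _)       = 1+n≢n (trans eq (cong (6 +_) k₂≡1+k₁))
    second-child _ (third _ d≡2 _)     =
      contradiction (∣⇒≤ (subst (5 + k₀ ∣_) d≡2 (greatest F₀∣))) λ { (s≤s (s≤s ())) }
  impossible (inj₂ (inj₂ siblings)) _ _ with InChainSiblings.F₁∈ siblings
  ... | inj₂ F₀<F = <⇒≱ F₀<F (subst (λ k₀ → 5 + k ≤ 5 + k₀) (sym (InChainSiblings.k₂≡1+k₁ siblings)) (n≤1+n _))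

module _ {Λ₁ Λ₁′ : NumericalSemigroup} (D₁ : InChainData Λ₁) (mem₁ : IsQuarticImage D₁ Λ₁′) where
  private
    module D₁ = InChainData D₁
    k = D₁.k

  quartic-F∉ : 5 + k ∉ Member Λ₁′
  quartic-F∉ F∈ with proj₁ mem₁ F∈
  ... | inj₁ F∈Λ , _ = D₁.F∉ F∈Λ
  ... | inj₂ () , _

  quartic-above∈ : ∀ {x} → 5 + k < x → x ∈ Member Λ₁′
  quartic-above∈ F<x = proj₂ mem₁ (inj₁ (D₁.above∈ F<x) , λ { refl → <⇒≱ F<x (n≤1+n _) })

  -- The largest gap of a sibling is `a`, and its predecessor is a member; the two largest gaps of a
  -- quartic image are the consecutive numbers `4 + k` and `5 + k`.
  quartic≢sibling : ∀ {D₂ : InChainData Λ₂} {a} → IsSibling D₂ a Λ₂′ → ¬ Member Λ₁′ ≐ Member Λ₂′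
  quartic≢sibling {Λ₂′ = Λ₂′} {D₂ = D₂} {a} S (⊆₁ , ⊆₂) with <-cmp a (5 + k)
  ... | tri< a<F₁ _ _ = quartic-F∉ (⊆₂ (F<x⇒∈ (<-trans F<a a<F₁) (<⇒≢ a<F₁ ∘ sym)))
    where open IsSibling S
  ... | tri> _ _ F₁<a = IsSibling.a∉ S (⊆₁ (quartic-above∈ F₁<a))
  ... | tri≈ _ refl _ = E∉ (⊆₂ E∈₂)
    where
    open IsSibling S
    E∉ : 4 + k ∉ Member Λ₁′
    E∉ E∈′ = proj₂ (proj₁ mem₁ E∈′) refl
    E∈₂ : 4 + k ∈ Member Λ₂′
    E∈₂ with m≤n⇒m<n∨m≡n (s≤s⁻¹ F<a)
    ... | inj₁ F₂<E = F<x⇒∈ F₂<E λ ()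
    ... | inj₂ F₂≡E = proj₂ member (inj₂ (sym F₂≡E) , λ ())

quartic-≤ : ∀ (D₁ : InChainData Λ₁) (D₂ : InChainData Λ₂) →
  IsQuarticImage D₁ Λ₁′ → IsQuarticImage D₂ Λ₂′ → Member Λ₁′ ⊆ Member Λ₂′ →
  InChainData.k D₂ ≤ InChainData.k D₁
quartic-≤ {Λ₁′ = Λ₁′} {Λ₂′ = Λ₂′} D₁ D₂ mem₁ mem₂ ⊆ = ≮⇒≥ λ k₁<k₂ →
  quartic-F∉ {Λ₁′ = Λ₂′} D₂ mem₂ (⊆ (quartic-above∈ {Λ₁′ = Λ₁′} D₁ mem₁ (+-monoʳ-< 5 k₁<k₂)))

quartic-⊆ : ∀ {D₁ : InChainData Λ₁} {k} → k ≡ InChainData.k D₁ →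
  Member Λ₁′ ≐ Exchanged Λ₁ (3 + k) (4 + k) → 4 + k ∈ Member Λ₁ →
  Member Λ₂′ ≐ Exchanged Λ₂ (3 + k) (4 + k) → 4 + k ∈ Member Λ₂ →
  Member Λ₁′ ⊆ Member Λ₂′ → Member Λ₁ ⊆ Member Λ₂
quartic-⊆ {D₁ = D₁} {k} refl mem₁ E₁∈ mem₂ E₂∈ ⊆ {x} x∈ with x ≟ 4 + k
... | yes refl = E₂∈
... | no x≢E with proj₁ mem₂ (⊆ (proj₂ mem₁ (inj₁ x∈ , x≢E)))
...   | inj₁ x∈₂ , _  = x∈₂
...   | inj₂ refl , _ = contradiction (n<1+n _) (InChainData.not-consecutive D₁ x∈ E₁∈)

even-or-odd : ∀ x → 2 ∣ x ⊎ 2 ∣ suc x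
even-or-odd zero = inj₁ (2 ∣0)
even-or-odd (suc x) with even-or-odd x
... | inj₁ 2∣x   = inj₂ (∣m∣n⇒∣m+n ∣-refl 2∣x)
... | inj₂ 2∣1+x = inj₁ 2∣1+x

-- Even numbers and those above `F₁` are in `Λ₁`. An odd `x ≤ F₁` in `Λ₂` would reach the odd number
-- `F₂` by adding an even one.
hyperelliptic-⊆ : ∀ {F₁ F₂} → IsFrobenius Λ₁ F₁ → IsFrobenius Λ₂ F₂ → 2 ∈ Member Λ₁ → 2 ∈ Member Λ₂ →
                  F₁ ≤ F₂ → Member Λ₂ ⊆ Member Λ₁
hyperelliptic-⊆ {Λ₁ = Λ₁} {Λ₂ = Λ₂} {F₁} {F₂} isF₁ isF₂ 2∈₁ 2∈₂ F₁≤F₂ {x} x∈ with F₁ <? x | even-or-odd x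
... | yes F₁<x | _          = IsFrobenius.above∈ isF₁ F₁<x
... | no _     | inj₁ 2∣x   = multiple∈ Λ₁ 2∈₁ 2∣x
... | no F₁≮x  | inj₂ 2∣1+x = contradiction F₂∈ (IsFrobenius.F∉ isF₂)
  where
  x≤F₂ : x ≤ F₂
  x≤F₂ = ≤-trans (≮⇒≥ F₁≮x) F₁≤F₂
  F₂∈ : F₂ ∈ Member Λ₂
  F₂∈ with even-or-odd F₂
  ... | inj₁ 2∣F₂   = multiple∈ Λ₂ 2∈₂ 2∣F₂
  ... | inj₂ 2∣1+F₂ = subst (Member Λ₂) (m+[n∸m]≡n x≤F₂) (+-closed Λ₂ x∈ (multiple∈ Λ₂ 2∈₂
          (∣m+n∣m⇒∣n {m = suc x} (subst (2 ∣_) (sym (cong suc (m+[n∸m]≡n x≤F₂))) 2∣1+F₂) 2∣1+x)))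

image-injective : ∀ {D₁ : InChainData Λ₁} {D₂ : InChainData Λ₂} → genus Λ₁ ≡ genus Λ₂ →
  Image D₁ Λ₁′ → Image D₂ Λ₂′ → Member Λ₁′ ≐ Member Λ₂′ → Member Λ₁ ≐ Member Λ₂
image-injective {Λ₁ = Λ₁} {Λ₂ = Λ₂} {Λ₁′ = Λ₁′} {Λ₂′ = Λ₂′} {D₁ = D₁} {D₂} genus≡ = injective
  where
  flip : {A B : Pred ℕ 0ℓ} → A ≐ B → B ≐ A
  flip (⊆₁ , ⊆₂) = ⊆₂ , ⊆₁
  generic-sibling : ∀ {Λ} {D : InChainData Λ} {Λ′ a} → 2 ∉ Member Λ → Choice D a →
             Member Λ′ ≐ Exchanged Λ (InChainData.F D) a → IsSibling D a Λ′
  generic-sibling {D = D} 2∉ c mem = isSibling (proj₁ (choice-bounds D (2∉⇒3≤m D 2∉) c)) mem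
  ordinary-sibling : ∀ k {Λ′} → Member Λ′ ≐ Exchanged (ordinary (5 + k)) (5 + k) (8 + k) →
                     IsSibling (ordinary-data k) (8 + k) Λ′
  ordinary-sibling k = isSibling (m<n+m (5 + k) (z<s {2}))
  injective : Image D₁ Λ₁′ → Image D₂ Λ₂′ → Member Λ₁′ ≐ Member Λ₂′ → Member Λ₁ ≐ Member Λ₂
  injective (generic 2∉₁ c₁ mem₁) (generic 2∉₂ c₂ mem₂) eq
    with compare-siblings {Λ₁′ = Λ₁′} {Λ₂′ = Λ₂′} (generic-sibling 2∉₁ c₁ mem₁) (generic-sibling 2∉₂ c₂ mem₂) eq
  ... | _   , inj₁ (Λ₁≐Λ₂ , _) = Λ₁≐Λ₂
  ... | a≡  , inj₂ (inj₁ S)    = contradiction c₂ (distinct-choices S a≡ c₁)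
  ... | a≡  , inj₂ (inj₂ S)    = contradiction c₁ (distinct-choices S (sym a≡) c₂)
  injective (generic 2∉₁ c₁ mem₁) (quartic _ mem₂) eq =
    contradiction (flip eq) (quartic≢sibling {Λ₁′ = Λ₂′} D₂ mem₂ {Λ₂′ = Λ₁′} (generic-sibling 2∉₁ c₁ mem₁))
  injective (quartic _ mem₁) (generic 2∉₂ c₂ mem₂) eq =
    contradiction eq (quartic≢sibling {Λ₁′ = Λ₁′} D₁ mem₁ {Λ₂′ = Λ₂′} (generic-sibling 2∉₂ c₂ mem₂))
  injective (quartic _ mem₁) (hyperelliptic _ k mem₂) eq =
    contradiction eq (quartic≢sibling {Λ₁′ = Λ₁′} D₁ mem₁ {Λ₂′ = Λ₂′} (ordinary-sibling k mem₂))
  injective (hyperelliptic _ k mem₁) (quartic _ mem₂) eq =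
    contradiction (flip eq) (quartic≢sibling {Λ₁′ = Λ₂′} D₂ mem₂ {Λ₂′ = Λ₁′} (ordinary-sibling k mem₁))
  injective (generic 2∉₁ c₁ mem₁) (hyperelliptic _ k mem₂) eq =
    contradiction (flip eq) (ordinary-sibling≢ {Λ₁′ = Λ₂′} {Λ₂′ = Λ₁′} c₁
      (ordinary-sibling k mem₂) (generic-sibling 2∉₁ c₁ mem₁))
  injective (hyperelliptic _ k mem₁) (generic 2∉₂ c₂ mem₂) eq =
    contradiction eq (ordinary-sibling≢ {Λ₁′ = Λ₁′} {Λ₂′ = Λ₂′} c₂
      (ordinary-sibling k mem₁) (generic-sibling 2∉₂ c₂ mem₂))
  injective (quartic E₁∈ mem₁) (quartic E₂∈ mem₂) eq@(⊆₁ , ⊆₂) =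
    quartic-⊆ {Λ₁′ = Λ₁′} {Λ₂′ = Λ₂′} {Λ₂ = Λ₂} {D₁ = D₁} refl mem₁ E₁∈ mem₂′ E₂∈′ ⊆₁ ,
    quartic-⊆ {Λ₁′ = Λ₂′} {Λ₂′ = Λ₁′} {Λ₂ = Λ₁} {D₁ = D₂} k≡ mem₂′ E₂∈′ mem₁ E₁∈ ⊆₂
    where
    k≡ : InChainData.k D₁ ≡ InChainData.k D₂
    k≡ = ≤-antisym (quartic-≤ {Λ₁′ = Λ₂′} {Λ₂′ = Λ₁′} D₂ D₁ mem₂ mem₁ ⊆₂)
                   (quartic-≤ {Λ₁′ = Λ₁′} {Λ₂′ = Λ₂′} D₁ D₂ mem₁ mem₂ ⊆₁)
    E₂∈′ = subst (λ k → 4 + k ∈ Member Λ₂) (sym k≡) E₂∈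
    mem₂′ = subst (λ k → Member Λ₂′ ≐ Exchanged Λ₂ (3 + k) (4 + k)) (sym k≡) mem₂
  -- Semigroups containing 2 are comparable by inclusion, and equal genus then makes them equal.
  injective (hyperelliptic 2∈₁ _ _) (hyperelliptic 2∈₂ _ _) _
    with ≤-total (InChainData.F D₁) (InChainData.F D₂)
  ... | inj₁ F₁≤F₂ = ⊆-same-genus {Λ₁} {Λ₂} Λ₂⊆Λ₁ genus≡ , Λ₂⊆Λ₁
    where
    Λ₂⊆Λ₁ : Member Λ₂ ⊆ Member Λ₁
    Λ₂⊆Λ₁ = hyperelliptic-⊆ (InChainData.isF D₁) (InChainData.isF D₂) 2∈₁ 2∈₂ F₁≤F₂
  ... | inj₂ F₂≤F₁ = Λ₁⊆Λ₂ , ⊆-same-genus {Λ₂} {Λ₁} Λ₁⊆Λ₂ (sym genus≡)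
    where
    Λ₁⊆Λ₂ : Member Λ₁ ⊆ Member Λ₂
    Λ₁⊆Λ₂ = hyperelliptic-⊆ (InChainData.isF D₂) (InChainData.isF D₁) 2∈₂ 2∈₁ F₂≤F₁

-- Counting the in-chain semigroups together with their images

theorem4p10 : (g : ℕ) → 5 ≤ g →
    ∃₂ λ (n i : ℕ) → CountOfGenus g n × CountInChainsOfGenus g i × 2 * i ≤ n
theorem4p10 g 5≤g
  with OfGenus.count-of-genus g
     | OfGenus.count-in-chains g (λ Λ g≡ → inInfiniteChain? Λ (subst (0 <_) (sym g≡) (<-≤-trans z<s 5≤g)))
... | n , of-genus | i , in-chains = n , i , of-genus , in-chains ,
  -- `2 * i` reduces to `i + (i + 0)`; the bound comes from an injection of `Fin (i + i)` into
  -- `Fin n`.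
  subst (_≤ n) (cong (i +_) (sym (+-identityʳ i)))
    (injective⇒≤ {f = index ∘ splitAt i} λ {j} {k} eq → splitAt-injective j k (index-injective _ _ eq))
  where
  module G = Inverse of-genus
  module C = Inverse in-chains
  inChain : Fin i → NumericalSemigroup
  inChain j = proj₁ (C.to j)
  genus≡ : ∀ j → genus (inChain j) ≡ g
  genus≡ j = proj₁ (proj₂ (C.to j))
  5≤genus : ∀ j → 5 ≤ genus (inChain j)
  5≤genus j = subst (5 ≤_) (sym (genus≡ j)) 5≤g
  data′ : ∀ j → InChainData (inChain j)
  data′ j = inChainData (5≤genus j) (proj₂ (proj₂ (C.to j)))
  images : ∀ j → ∃ λ Λ′ → genus Λ′ ≡ genus (inChain j) × CoprimeSmalls Λ′ × Image (data′ j) Λ′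
  images j = image (data′ j) (5≤genus j)
  partner : Fin i → NumericalSemigroup
  partner j = proj₁ (images j)
  -- The first copy of `Fin i` stands for the in-chain semigroups, the second for their images.
  index : Fin i ⊎ Fin i → Fin n
  index (inj₁ j) = G.from (inChain j , genus≡ j)
  index (inj₂ j) = G.from (partner j , trans (proj₁ (proj₂ (images j))) (genus≡ j))
  not-image : ∀ j k → ¬ Member (inChain j) ≐ Member (partner k)
  not-image j k (⊆₁ , ⊆₂) = InChainData.d≢1 (data′ j)
    (proj₁ (proj₂ (proj₂ (images k))) λ (x∈ , y , x<y , y∉) →
      InChainData.divides (data′ j) (⊆₂ x∈ , y , x<y , y∉ ∘ ⊆₁))
  index-injective : ∀ s t → index s ≡ index t → s ≡ t
  index-injective (inj₁ j) (inj₁ k) eq = cong inj₁ (to-injective in-chains (from-injective of-genus eq))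
  index-injective (inj₁ j) (inj₂ k) eq = contradiction (from-injective of-genus eq) (not-image j k)
  index-injective (inj₂ j) (inj₁ k) eq = contradiction (from-injective of-genus (sym eq)) (not-image k j)
  index-injective (inj₂ j) (inj₂ k) eq = cong inj₂ (to-injective in-chains
    (image-injective {Λ₁′ = partner j} {Λ₂′ = partner k} (trans (genus≡ j) (sym (genus≡ k)))
      (proj₂ (proj₂ (proj₂ (images j)))) (proj₂ (proj₂ (proj₂ (images k)))) (from-injective of-genus eq)))
  splitAt-injective : ∀ j k → splitAt i {i} j ≡ splitAt i k → j ≡ k
  splitAt-injective j k eq =
    trans (sym (join-splitAt i i j)) (trans (cong (join i i) eq) (join-splitAt i i k))
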